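{- With $A(n)$ and $A'(n)$ as defined in the context: (a) $$\sum_{n\ge1}A(n)q^n=2q(-q^2;q)_\infty^2(-q^2;q^2)_\infty^2-\frac{q}{(1+q)^2}=2q(-q^2;q)_\infty^2(-q^2;q^2)_\infty^2+\sum_{n\ge1}(-1)^n n q^n;$$ (b) $$\sum_{n\ge1}A'(n)q^n=\frac{q}{(1-q)^2}=\sum_{n\ge1}nq^n.$$
   Context: $(a;q)_\infty=\prod_{j\ge0}(1-aq^j)$, $|q|<1$. A two-color partition is a partition whose parts are each colored blue or green (the same integer may occur in both colors). For a positive integer $n$, $A(n)$ is the number of two-color partitions of $n$ in which: the smallest part $s$ is odd, occurs at least once in blue, and every blue even part is at least $s+3$; no even integer occurs more than once in the same color (odd parts of either color may repeat). $A_0(n)$ (resp. $A_1(n)$) is the number of partitions counted by $A(n)$ whose total number of even parts (both colors) is even (resp. odd), and $A'(n)=A_0(n)-A_1(n)$. Equivalently, $\sum_{n\ge1}A(n)q^n=\sum_{n\ge0}\frac{q^{2n+1}(-q^{2n+4};q^2)_\infty(-q^{2n+2};q^2)_\infty}{(q^{2n+1};q^2)_\infty^2}$ and $\sum_{n\ge1}A'(n)q^n=\sum_{n\ge0}\frac{q^{2n+1}(q^{2n+4};q^2)_\infty(q^{2n+2};q^2)_\infty}{(q^{2n+1};q^2)_\infty^2}$. -}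

module Defs where

open import Data.Nat as ℕ using (ℕ; zero; suc; _≤_; _≥_; _∸_)
open import Data.Nat.Divisibility using (_∣_; _∣?_)
open import Data.Integer as ℤ using (ℤ; +_; -_)
open import Data.List using (List; []; _∷_; _++_; length; filter)
open import Data.Nat.ListAction using (sum)
open import Data.List.Relation.Unary.All using (All)
open import Data.List.Relation.Unary.AllPairs using (AllPairs)
open import Data.List.Relation.Unary.Unique.Propositional using (Unique)
open import Data.List.Membership.Propositional using (_∈_)
open import Data.Product using (Σ; _×_; _,_)
open import Function.Bundles using (_⇔_)
open import Relation.Nullary using (¬_)
open import Relation.Binary.PropositionalEquality using (_≡_; _≢_)

HasCount : {X : Set} → (X → Set) → ℕ → Set
HasCount {X} P c =
  Σ (List X) λ xs → Unique xs × (∀ x → P x ⇔ (x ∈ xs)) × (length xs ≡ c)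

-- Two-color partitions: a pair (blue parts, green parts), each list
-- weakly decreasing with positive entries.

TwoColor : Set
TwoColor = List ℕ × List ℕ

Even : ℕ → Set
Even x = 2 ∣ x

Odd : ℕ → Set
Odd x = ¬ (2 ∣ x)

IsPartitionList : List ℕ → Set
IsPartitionList xs = AllPairs _≥_ xs × All (1 ≤_) xs

IsA : ℕ → TwoColor → Set
IsA n (b , g) =
  IsPartitionList b × IsPartitionList g ×
  (sum b ℕ.+ sum g ≡ n) ×
  (Σ ℕ λ s → (s ∈ b) × Odd s × All (s ≤_) (b ++ g) ×
     All (λ x → Even x → s ℕ.+ 3 ≤ x) b) ×
  AllPairs (λ x y → Even x → x ≢ y) b ×
  AllPairs (λ x y → Even x → x ≢ y) g

numEven : TwoColor → ℕ
numEven (b , g) = length (filter (2 ∣?_) (b ++ g))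

IsA₀ : ℕ → TwoColor → Set
IsA₀ n p = IsA n p × Even (numEven p)

IsA₁ : ℕ → TwoColor → Set
IsA₁ n p = IsA n p × Odd (numEven p)

Series : Set
Series = ℕ → ℤ

_≈ₛ_ : Series → Series → Set
f ≈ₛ g = ∀ m → f m ≡ g m

infixl 7 _*ₛ_
infixl 6 _+ₛ_

_+ₛ_ : Series → Series → Series
(f +ₛ g) m = f m ℤ.+ g m

sumTo : ℕ → (ℕ → ℤ) → ℤ
sumTo zero h = h 0
sumTo (suc n) h = sumTo n h ℤ.+ h (suc n)

_*ₛ_ : Series → Series → Series
(f *ₛ g) m = sumTo m (λ i → f i ℤ.* g (m ∸ i))

mono : ℤ → ℕ → Series
mono c k m with k ℕ.≟ m
... | Relation.Nullary.yes _ = c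
... | Relation.Nullary.no _ = + 0

oneₛ : Series
oneₛ = mono (+ 1) 0

finNegPoch : ℕ → ℕ → ℕ → Series
finNegPoch a d zero = oneₛ
finNegPoch a d (suc N) = finNegPoch a d N *ₛ (oneₛ +ₛ mono (+ 1) (a ℕ.+ d ℕ.* N))

-- (-q^a ; q^d)_∞ for a ≥ 1, d ≥ 1: the coefficient of q^m is that of the
-- finite product over j ≤ m (factors with j > m only affect degrees > m).
negPoch : ℕ → ℕ → Series
negPoch a d m = finNegPoch a d (suc m) m

Pₛ : Series
Pₛ = negPoch 2 1 *ₛ negPoch 2 1 *ₛ negPoch 2 2 *ₛ negPoch 2 2

twoQP : Series
twoQP = mono (+ 2) 1 *ₛ Pₛ

sgn : ℕ → ℤ
sgn zero = + 1
sgn (suc n) = - sgn n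

altNₛ : Series
altNₛ n = sgn n ℤ.* + n

natₛ : Series
natₛ n = + n

-- Let w = ±1 be the weight of an even part and put p = w q. Let v(l) count one-colour lists with parts
-- ≥ l and distinct even parts, and let B(s) count those with smallest part s and without the part s+1.
-- Removing the last (smallest) part gives, with x = q^s and s odd,
--   (1 - x) v(s) = (1 + p x) v(s+2)   and   (1 - x) B(s) = x v(s+2),
-- and these two relations make the sum over s telescope:
--   (1 + p)² B(s) v(s) = U(s) - U(s+2),   U(s) = (q^s + p) v(s)².
-- Since U(s) → p, the whole sum is ((q + p) v(1)² - p) / (1 + p)². For p = -q the first term vanishes, and
-- for p = q Euler's 1/(q;q²) = (-q;q) turns v(1) into (1 + q)(-q²;q)(-q²;q²).
-- Infinite products are avoided by working in ℤ[[q]]/(qⁿ⁺¹) for each n.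

module Submission where

open import Defs
open import Algebra.Bundles using (CommutativeRing)
import Algebra.Solver.Ring
open import Algebra.Solver.Ring.AlmostCommutativeRing
  using (fromCommutativeRing; _-Raw-AlmostCommutative⟶_)
open import Data.Integer using (ℤ; +_; -_; _+_; _-_; _*_; _^_; +-*-rawRing)
import Data.Integer.Properties as ℤ
open import Algebra.Properties.AbelianGroup ℤ.+-0-abelianGroup using (∙-cancelʳ)
open import Data.Integer.Tactic.RingSolver using (solve-∀)
open import Data.List
  using (List; []; _∷_; [_]; _++_; _∷ʳ_; length; map; filter; cartesianProduct; initLast; _∷ʳ′_)
open import Data.List.Membership.DecPropositional using (_∈?_)
open import Data.List.Membership.Propositional using (_∈_; _∉_)
open import Data.List.Membership.Propositional.Properties
  using (∈-map⁺; ∈-map⁻; ∈-++⁺ˡ; ∈-++⁺ʳ; ∈-++⁻; ∈-cartesianProduct⁺; ∈-cartesianProduct⁻; ∈-filter⁺; ∈-filter⁻)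
open import Data.List.Membership.Propositional.Properties.WithK using (unique∧set⇒bag)
open import Data.List.Properties using (length-++; filter-++; filter-accept; filter-reject; ∷ʳ-injectiveˡ)
open import Data.List.Relation.Binary.BagAndSetEquality using (∼bag⇒↭)
open import Data.List.Relation.Binary.Permutation.Propositional as ↭ using (_↭_)
open import Data.List.Relation.Unary.All as All using (All; []; _∷_)
import Data.List.Relation.Unary.All.Properties as All
open import Data.List.Relation.Unary.AllPairs using (AllPairs; []; _∷_)
import Data.List.Relation.Unary.AllPairs.Properties as AllPairs
open import Data.List.Relation.Unary.Any using (here; there)
open import Data.List.Relation.Unary.Unique.Propositional using (Unique)
import Data.List.Relation.Unary.Unique.Propositional.Properties as Unique
open import Data.Maybe using (Maybe; just; nothing)
open import Data.Nat as ℕ using (ℕ; zero; suc; _≤_; _<_; _≥_; _∸_; z≤n; s≤s)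
open import Data.Nat.Divisibility using (_∣_; _∣?_; divides; ∣m+n∣m⇒∣n; ∣-refl; ∣1⇒≡1)
open import Data.Nat.ListAction using (sum)
open import Data.Nat.ListAction.Properties using (sum-++)
import Data.Nat.Properties as ℕ
open import Data.Product using (Σ; ∃; _×_; _,_; proj₁; proj₂)
open import Data.Sum using (_⊎_; inj₁; inj₂; [_,_]′)
open import Function using (_∘_)
open import Function.Bundles using (_⇔_; mk⇔; Equivalence)
open import Function.Properties.Equivalence using () renaming (sym to ⇔-sym; trans to ⇔-trans)
open import Relation.Binary.PropositionalEquality
  using (_≡_; _≢_; refl; sym; trans; cong; cong₂; subst; module ≡-Reasoning)
import Relation.Binary.Reasoning.Setoid
open import Relation.Nullary using (¬_; Dec; yes; no; contradiction; ¬?; _×-dec_)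
open import Relation.Unary using (Decidable)

open Equivalence using (to; from)

-- The ring of truncated power series

-- Both halves of the theorem are one computation: with w = 1 the weighted sum is a count, with w =
-- -1 it is the even count minus the odd count, and the telescoping uses only w² = 1. No generating
-- function is written down in advance. A coefficient is the weighted sum of a duplicate-free list
-- of all objects of a given size, and two such lists for the same predicate have the same sum. A
-- bijection such as removing the smallest part therefore becomes an identity of series, and these
-- identities are all that the algebra needs to know about the lists. Truncation turns the analytic
-- steps into exact ones: modulo qⁿ⁺¹ the sum over s stops, U(s) equals p as soon as s > n, and an
-- infinite product is a finite one. Division is replaced throughout by cancelling a factor with
-- constant term 1.

sumTo-suc : ∀ n h → sumTo (suc n) h ≡ h 0 + sumTo n (h ∘ suc)
sumTo-suc zero    h = refl
sumTo-suc (suc n) h = trans (cong (_+ h (suc (suc n))) (sumTo-suc n h)) (ℤ.+-assoc (h 0) _ _)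

*ₛ-suc : ∀ f g m → (f *ₛ g) (suc m) ≡ f 0 * g (suc m) + ((f ∘ suc) *ₛ g) m
*ₛ-suc f g m = sumTo-suc m _

-- A coefficient of a product involves no higher coefficients of the factors. This is what makes
-- truncation compatible with multiplication.
*ₛ-cong-≤ : ∀ m {f f′ g g′} → (∀ {i} → i ≤ m → f i ≡ f′ i) → (∀ {i} → i ≤ m → g i ≡ g′ i) →
            (f *ₛ g) m ≡ (f′ *ₛ g′) m
*ₛ-cong-≤ zero    p r = cong₂ _*_ (p z≤n) (r z≤n)
*ₛ-cong-≤ (suc m) {f} {f′} {g} {g′} p r = begin
  (f *ₛ g) (suc m)                              ≡⟨ *ₛ-suc f g m ⟩
  f 0 * g (suc m) + ((f ∘ suc) *ₛ g) m          ≡⟨ cong₂ _+_ (cong₂ _*_ (p z≤n) (r ℕ.≤-refl))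
                                                     (*ₛ-cong-≤ m (p ∘ s≤s) (r ∘ ℕ.m≤n⇒m≤1+n)) ⟩
  f′ 0 * g′ (suc m) + ((f′ ∘ suc) *ₛ g′) m      ≡⟨ *ₛ-suc f′ g′ m ⟨
  (f′ *ₛ g′) (suc m)                            ∎
  where open ≡-Reasoning

*ₛ-congʳ-≈ : ∀ {f f′} g → f ≈ₛ f′ → (f *ₛ g) ≈ₛ (f′ *ₛ g)
*ₛ-congʳ-≈ g p m = *ₛ-cong-≤ m {g = g} (λ {i} _ → p i) (λ _ → refl)

*ₛ-congˡ-≈ : ∀ f {g g′} → g ≈ₛ g′ → (f *ₛ g) ≈ₛ (f *ₛ g′)
*ₛ-congˡ-≈ f p m = *ₛ-cong-≤ m {f} (λ _ → refl) (λ {i} _ → p i)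

*ₛ-distribʳ : ∀ f g h → ((f +ₛ g) *ₛ h) ≈ₛ ((f *ₛ h) +ₛ (g *ₛ h))
*ₛ-distribʳ f g h zero    = ℤ.*-distribʳ-+ (h 0) (f 0) (g 0)
*ₛ-distribʳ f g h (suc m) = begin
  ((f +ₛ g) *ₛ h) (suc m)
    ≡⟨ *ₛ-suc (f +ₛ g) h m ⟩
  (f 0 + g 0) * h (suc m) + (((f ∘ suc) +ₛ (g ∘ suc)) *ₛ h) m
    ≡⟨ cong (_+_ ((f 0 + g 0) * h (suc m))) (*ₛ-distribʳ (f ∘ suc) (g ∘ suc) h m) ⟩
  (f 0 + g 0) * h (suc m) + (((f ∘ suc) *ₛ h) m + ((g ∘ suc) *ₛ h) m)
    ≡⟨ rearrange (f 0) (g 0) (h (suc m)) _ _ ⟩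
  (f 0 * h (suc m) + ((f ∘ suc) *ₛ h) m) + (g 0 * h (suc m) + ((g ∘ suc) *ₛ h) m)
    ≡⟨ cong₂ _+_ (*ₛ-suc f h m) (*ₛ-suc g h m) ⟨
  (f *ₛ h) (suc m) + (g *ₛ h) (suc m) ∎
  where
  open ≡-Reasoning
  rearrange : ∀ a b c x y → (a + b) * c + (x + y) ≡ (a * c + x) + (b * c + y)
  rearrange = solve-∀

scale : ℤ → Series → Series
scale c f m = c * f m

scale-*ₛ : ∀ c f g → (scale c f *ₛ g) ≈ₛ scale c (f *ₛ g)
scale-*ₛ c f g zero    = ℤ.*-assoc c (f 0) (g 0)
scale-*ₛ c f g (suc m) = begin
  (scale c f *ₛ g) (suc m)
    ≡⟨ *ₛ-suc (scale c f) g m ⟩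
  c * f 0 * g (suc m) + (scale c (f ∘ suc) *ₛ g) m
    ≡⟨ cong₂ _+_ (ℤ.*-assoc c (f 0) _) (scale-*ₛ c (f ∘ suc) g m) ⟩
  c * (f 0 * g (suc m)) + c * ((f ∘ suc) *ₛ g) m
    ≡⟨ ℤ.*-distribˡ-+ c _ _ ⟨
  c * (f 0 * g (suc m) + ((f ∘ suc) *ₛ g) m)
    ≡⟨ cong (c *_) (*ₛ-suc f g m) ⟨
  c * (f *ₛ g) (suc m) ∎
  where open ≡-Reasoning

*ₛ-assoc : ∀ f g h → ((f *ₛ g) *ₛ h) ≈ₛ (f *ₛ (g *ₛ h))
*ₛ-assoc f g h zero    = ℤ.*-assoc (f 0) (g 0) (h 0)
*ₛ-assoc f g h (suc m) = begin
  ((f *ₛ g) *ₛ h) (suc m)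
    ≡⟨ *ₛ-suc (f *ₛ g) h m ⟩
  f 0 * g 0 * h (suc m) + (((f *ₛ g) ∘ suc) *ₛ h) m
    ≡⟨ cong (_+_ (f 0 * g 0 * h (suc m))) (*ₛ-congʳ-≈ h (*ₛ-suc f g) m) ⟩
  f 0 * g 0 * h (suc m) + ((scale (f 0) (g ∘ suc) +ₛ ((f ∘ suc) *ₛ g)) *ₛ h) m
    ≡⟨ cong (_+_ (f 0 * g 0 * h (suc m))) (*ₛ-distribʳ (scale (f 0) (g ∘ suc)) ((f ∘ suc) *ₛ g) h m) ⟩
  f 0 * g 0 * h (suc m) + ((scale (f 0) (g ∘ suc) *ₛ h) m + (((f ∘ suc) *ₛ g) *ₛ h) m)
    ≡⟨ cong (_+_ (f 0 * g 0 * h (suc m))) (cong₂ _+_ (scale-*ₛ (f 0) (g ∘ suc) h m) (*ₛ-assoc (f ∘ suc) g h m)) ⟩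
  f 0 * g 0 * h (suc m) + (f 0 * ((g ∘ suc) *ₛ h) m + ((f ∘ suc) *ₛ (g *ₛ h)) m)
    ≡⟨ rearrange (f 0) (g 0) (h (suc m)) _ _ ⟩
  f 0 * (g 0 * h (suc m) + ((g ∘ suc) *ₛ h) m) + ((f ∘ suc) *ₛ (g *ₛ h)) m
    ≡⟨ cong (λ z → f 0 * z + ((f ∘ suc) *ₛ (g *ₛ h)) m) (*ₛ-suc g h m) ⟨
  f 0 * (g *ₛ h) (suc m) + ((f ∘ suc) *ₛ (g *ₛ h)) m
    ≡⟨ *ₛ-suc f (g *ₛ h) m ⟨
  (f *ₛ (g *ₛ h)) (suc m) ∎
  where
  open ≡-Reasoning
  rearrange : ∀ a b c x y → a * b * c + (a * x + y) ≡ a * (b * c + x) + y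
  rearrange = solve-∀

-- Peeling the head off one factor and then off the other leaves a product of two tails whose degree
-- has dropped by two, hence the two base cases.
*ₛ-comm : ∀ f g → (f *ₛ g) ≈ₛ (g *ₛ f)
*ₛ-comm f g zero          = ℤ.*-comm (f 0) (g 0)
*ₛ-comm f g (suc zero)    = rearrange (f 0) (f 1) (g 0) (g 1)
  where
  rearrange : ∀ a b c d → a * d + b * c ≡ c * b + d * a
  rearrange = solve-∀
*ₛ-comm f g (suc (suc m)) = begin
  (f *ₛ g) (suc (suc m))
    ≡⟨ *ₛ-suc f g (suc m) ⟩
  f 0 * g (suc (suc m)) + (f′ *ₛ g) (suc m)
    ≡⟨ cong (_+_ (f 0 * g (suc (suc m)))) (trans (*ₛ-comm f′ g (suc m)) (*ₛ-suc g f′ m)) ⟩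
  f 0 * g (suc (suc m)) + (g 0 * f (suc (suc m)) + (g′ *ₛ f′) m)
    ≡⟨ cong (λ z → f 0 * g (suc (suc m)) + (g 0 * f (suc (suc m)) + z)) (*ₛ-comm g′ f′ m) ⟩
  f 0 * g (suc (suc m)) + (g 0 * f (suc (suc m)) + (f′ *ₛ g′) m)
    ≡⟨ rearrange (f 0 * g (suc (suc m))) (g 0 * f (suc (suc m))) _ ⟩
  g 0 * f (suc (suc m)) + (f 0 * g (suc (suc m)) + (f′ *ₛ g′) m)
    ≡⟨ cong (_+_ (g 0 * f (suc (suc m)))) (trans (*ₛ-comm g′ f (suc m)) (*ₛ-suc f g′ m)) ⟨
  g 0 * f (suc (suc m)) + (g′ *ₛ f) (suc m)
    ≡⟨ *ₛ-suc g f (suc m) ⟨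
  (g *ₛ f) (suc (suc m)) ∎
  where
  open ≡-Reasoning
  f′ g′ : Series
  f′ = f ∘ suc
  g′ = g ∘ suc
  rearrange : ∀ a b c → a + (b + c) ≡ b + (a + c)
  rearrange = solve-∀

zeroₛ : Series
zeroₛ _ = + 0

-ₛ_ : Series → Series
(-ₛ f) m = - f m

*ₛ-zeroˡ : ∀ f → (zeroₛ *ₛ f) ≈ₛ zeroₛ
*ₛ-zeroˡ f zero    = refl
*ₛ-zeroˡ f (suc m) = trans (*ₛ-suc zeroₛ f m) (trans (ℤ.+-identityˡ _) (*ₛ-zeroˡ f m))

mono-≡ : ∀ c k → mono c k k ≡ c
mono-≡ c k with k ℕ.≟ k
... | yes _  = refl
... | no k≢k = contradiction refl k≢k

mono-≢ : ∀ c {k m} → k ≢ m → mono c k m ≡ + 0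
mono-≢ c {k} {m} k≢m with k ℕ.≟ m
... | yes k≡m = contradiction k≡m k≢m
... | no _    = refl

mono-suc : ∀ c k m → mono c (suc k) (suc m) ≡ mono c k m
mono-suc c k m with k ℕ.≟ m
... | yes refl = mono-≡ c (suc k)
... | no k≢m   = mono-≢ c (k≢m ∘ ℕ.suc-injective)

mono-*-< : ∀ c f {k m} → m < k → (mono c k *ₛ f) m ≡ + 0
mono-*-< c f {k} {m} m<k = trans
  (*ₛ-cong-≤ m {g = f} (λ i≤m → mono-≢ c (λ k≡i → ℕ.<⇒≱ m<k (ℕ.≤-trans (ℕ.≤-reflexive k≡i) i≤m)))
     (λ _ → refl))
  (*ₛ-zeroˡ f m)

mono-*-+ : ∀ c f k m → (mono c k *ₛ f) (k ℕ.+ m) ≡ c * f m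
mono-*-+ c f zero zero    = refl
mono-*-+ c f zero (suc m) = begin
  (mono c 0 *ₛ f) (suc m)                  ≡⟨ *ₛ-suc (mono c 0) f m ⟩
  c * f (suc m) + ((mono c 0 ∘ suc) *ₛ f) m ≡⟨ cong (_+_ (c * f (suc m))) (*ₛ-zeroˡ f m) ⟩
  c * f (suc m) + + 0                      ≡⟨ ℤ.+-identityʳ _ ⟩
  c * f (suc m)                            ∎
  where open ≡-Reasoning
mono-*-+ c f (suc k) m = begin
  (mono c (suc k) *ₛ f) (suc (k ℕ.+ m))
    ≡⟨ *ₛ-suc (mono c (suc k)) f (k ℕ.+ m) ⟩
  + 0 + ((mono c (suc k) ∘ suc) *ₛ f) (k ℕ.+ m)
    ≡⟨ ℤ.+-identityˡ _ ⟩
  ((mono c (suc k) ∘ suc) *ₛ f) (k ℕ.+ m)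
    ≡⟨ *ₛ-congʳ-≈ f (mono-suc c k) (k ℕ.+ m) ⟩
  (mono c k *ₛ f) (k ℕ.+ m)
    ≡⟨ mono-*-+ c f k m ⟩
  c * f m ∎
  where open ≡-Reasoning

mono-*-mono : ∀ c k d l → (mono c k *ₛ mono d l) ≈ₛ mono (c * d) (k ℕ.+ l)
mono-*-mono c k d l m with ℕ.≤-<-connex k m
... | inj₂ m<k = trans (mono-*-< c (mono d l) m<k)
                       (sym (mono-≢ (c * d) λ e → ℕ.<⇒≱ m<k (ℕ.≤-trans (ℕ.m≤m+n k l) (ℕ.≤-reflexive e))))
... | inj₁ k≤m with m ∸ k | ℕ.m+[n∸m]≡n k≤m
... | r | refl with l ℕ.≟ r
... | yes refl = trans (mono-*-+ c (mono d l) k l) (trans (cong (c *_) (mono-≡ d l)) (sym (mono-≡ (c * d) (k ℕ.+ l))))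
... | no l≢r   = trans (mono-*-+ c (mono d l) k r)
                   (trans (cong (c *_) (mono-≢ d l≢r))
                     (trans (ℤ.*-zeroʳ c) (sym (mono-≢ (c * d) (l≢r ∘ ℕ.+-cancelˡ-≡ k l r)))))

*ₛ-identityˡ : ∀ f → (oneₛ *ₛ f) ≈ₛ f
*ₛ-identityˡ f m = trans (mono-*-+ (+ 1) f 0 m) (ℤ.*-identityˡ (f m))

-- Equality in ℤ[[q]]/(qⁿ⁺¹).
record Agree (n : ℕ) (f g : Series) : Set where
  constructor mk
  field at : ∀ {m} → m ≤ n → f m ≡ g m
open Agree public

≈⇒Agree : ∀ {n f g} → f ≈ₛ g → Agree n f g
≈⇒Agree p = mk λ {m} _ → p m

truncated : ℕ → CommutativeRing _ _
truncated n = record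
  { Carrier = Series
  ; _≈_ = Agree n
  ; _+_ = _+ₛ_
  ; _*_ = _*ₛ_
  ; -_ = -ₛ_
  ; 0# = zeroₛ
  ; 1# = oneₛ
  ; isCommutativeRing = record
    { isRing = record
      { +-isAbelianGroup = record
        { isGroup = record
          { isMonoid = record
            { isSemigroup = record
              { isMagma = record
                { isEquivalence = record
                  { refl = mk λ _ → refl
                  ; sym = λ p → mk λ m≤n → sym (at p m≤n)
                  ; trans = λ p r → mk λ m≤n → trans (at p m≤n) (at r m≤n)
                  }
                ; ∙-cong = λ p r → mk λ m≤n → cong₂ _+_ (at p m≤n) (at r m≤n)
                }
              ; assoc = λ f g h → mk λ {m} _ → ℤ.+-assoc (f m) (g m) (h m)
              }
            ; identity = (λ f → mk λ {m} _ → ℤ.+-identityˡ (f m))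
                       , (λ f → mk λ {m} _ → ℤ.+-identityʳ (f m))
            }
          ; inverse = (λ f → mk λ {m} _ → ℤ.+-inverseˡ (f m))
                    , (λ f → mk λ {m} _ → ℤ.+-inverseʳ (f m))
          ; ⁻¹-cong = λ p → mk λ m≤n → cong -_ (at p m≤n)
          }
        ; comm = λ f g → mk λ {m} _ → ℤ.+-comm (f m) (g m)
        }
      ; *-cong = λ p r → mk λ {m} m≤n →
          *ₛ-cong-≤ m (λ i≤m → at p (ℕ.≤-trans i≤m m≤n)) (λ i≤m → at r (ℕ.≤-trans i≤m m≤n))
      ; *-assoc = λ f g h → ≈⇒Agree (*ₛ-assoc f g h)
      ; *-identity = (λ f → ≈⇒Agree (*ₛ-identityˡ f))
                   , (λ f → ≈⇒Agree (λ m → trans (*ₛ-comm f oneₛ m) (*ₛ-identityˡ f m)))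
      ; distrib = (λ f g h → ≈⇒Agree (λ m → trans (*ₛ-comm f (g +ₛ h) m)
                     (trans (*ₛ-distribʳ g h f m) (cong₂ _+_ (*ₛ-comm g f m) (*ₛ-comm h f m)))))
                , (λ h f g → ≈⇒Agree (*ₛ-distribʳ f g h))
      }
    ; *-comm = λ f g → ≈⇒Agree (*ₛ-comm f g)
    }
  }

-- In degree m + 1 the product with `u` is the coefficient sought plus terms in lower ones, so the
-- coefficients are determined one after the other. Every division in the proof takes this form.
cancel : ∀ {n} u {f g} → u 0 ≡ + 1 → Agree n (u *ₛ f) (u *ₛ g) → Agree n f g
cancel {n} u {f} {g} u₀≡1 p = mk λ m≤n → below _ m≤n ℕ.≤-refl
  where
  open ≡-Reasoning
  below : ∀ m → m ≤ n → ∀ {i} → i ≤ m → f i ≡ g i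
  below zero    _    z≤n = begin
    f 0       ≡⟨ ℤ.*-identityˡ (f 0) ⟨
    + 1 * f 0 ≡⟨ cong (_* f 0) u₀≡1 ⟨
    u 0 * f 0 ≡⟨ at p z≤n ⟩
    u 0 * g 0 ≡⟨ cong (_* g 0) u₀≡1 ⟩
    + 1 * g 0 ≡⟨ ℤ.*-identityˡ (g 0) ⟩
    g 0       ∎
  below (suc m) sm≤n {i} i≤sm with ℕ.m≤n⇒m<n∨m≡n i≤sm
  ... | inj₁ (s≤s i≤m) = below m (ℕ.<⇒≤ sm≤n) i≤m
  ... | inj₂ refl      = ∙-cancelʳ (((u ∘ suc) *ₛ g) m) _ _ (begin
    f (suc m) + ((u ∘ suc) *ₛ g) m       ≡⟨ cong (_+_ (f (suc m))) (*ₛ-cong-≤ m {u ∘ suc} (λ _ → refl) (below m (ℕ.<⇒≤ sm≤n))) ⟨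
    f (suc m) + ((u ∘ suc) *ₛ f) m       ≡⟨ head f ⟨
    (u *ₛ f) (suc m)                     ≡⟨ at p sm≤n ⟩
    (u *ₛ g) (suc m)                     ≡⟨ head g ⟩
    g (suc m) + ((u ∘ suc) *ₛ g) m       ∎)
    where
    head : ∀ h → (u *ₛ h) (suc m) ≡ h (suc m) + ((u ∘ suc) *ₛ h) m
    head h = trans (*ₛ-suc u h m)
      (cong (_+ ((u ∘ suc) *ₛ h) m) (trans (cong (_* h (suc m)) u₀≡1) (ℤ.*-identityˡ (h (suc m)))))

module Truncated (n : ℕ) where

  open CommutativeRing (truncated n) public
    using (_≈_; setoid; *-cong; +-cong; -‿cong)
    renaming (refl to ≈-refl; sym to ≈-sym; trans to ≈-trans; reflexive to ≈-reflexive)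

  -- The fixed operand is explicit since _+ₛ_ and _*ₛ_ unfold during unification, so it cannot be inferred.
  +-congˡ : ∀ f {g h} → g ≈ h → f +ₛ g ≈ f +ₛ h
  +-congˡ f = +-cong (≈-refl {f})

  +-congʳ : ∀ f {g h} → g ≈ h → g +ₛ f ≈ h +ₛ f
  +-congʳ f p = +-cong p (≈-refl {f})

  *-congˡ : ∀ f {g h} → g ≈ h → f *ₛ g ≈ f *ₛ h
  *-congˡ f = *-cong (≈-refl {f})

  *-congʳ : ∀ f {g h} → g ≈ h → g *ₛ f ≈ h *ₛ f
  *-congʳ f p = *-cong p (≈-refl {f})

  constants : +-*-rawRing -Raw-AlmostCommutative⟶ fromCommutativeRing (truncated n)
  constants = record
    { ⟦_⟧    = λ c → mono c 0
    ; +-homo = λ c d → mk λ { {zero} _ → refl ; {suc m} _ → refl }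
    ; *-homo = λ c d → ≈-sym (≈⇒Agree (mono-*-mono c 0 d 0))
    ; -‿homo = λ c → mk λ { {zero} _ → refl ; {suc m} _ → refl }
    ; 0-homo = mk λ { {zero} _ → refl ; {suc m} _ → refl }
    ; 1-homo = ≈-refl
    }

  constant≟ : ∀ c d → Maybe (mono c 0 ≈ mono d 0)
  constant≟ c d with c ℤ.≟ d
  ... | yes refl = just ≈-refl
  ... | no _     = nothing

  module Solver = Algebra.Solver.Ring +-*-rawRing (fromCommutativeRing (truncated n)) constants constant≟

-- Weighted enumeration

wsum : {X : Set} → (X → ℤ) → List X → ℤ
wsum wt []       = + 0
wsum wt (x ∷ xs) = wt x + wsum wt xs

module _ {X : Set} (wt : X → ℤ) where

  wsum-++ : ∀ xs ys → wsum wt (xs ++ ys) ≡ wsum wt xs + wsum wt ys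
  wsum-++ []       ys = sym (ℤ.+-identityˡ _)
  wsum-++ (x ∷ xs) ys = trans (cong (_+_ (wt x)) (wsum-++ xs ys)) (sym (ℤ.+-assoc (wt x) _ _))

  wsum-↭ : ∀ {xs ys} → xs ↭ ys → wsum wt xs ≡ wsum wt ys
  wsum-↭ ↭.refl         = refl
  wsum-↭ (↭.prep x p)   = cong (_+_ (wt x)) (wsum-↭ p)
  wsum-↭ (↭.swap x y p) = trans (cong (λ z → wt x + (wt y + z)) (wsum-↭ p)) (swap (wt x) (wt y) _)
    where
    swap : ∀ a b c → a + (b + c) ≡ b + (a + c)
    swap = solve-∀
  wsum-↭ (↭.trans p r)  = trans (wsum-↭ p) (wsum-↭ r)

wsum-map : ∀ {X Y : Set} {wt : X → ℤ} {wt′ : Y → ℤ} {φ : X → Y} c →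
           (∀ x → wt′ (φ x) ≡ c * wt x) → ∀ xs → wsum wt′ (map φ xs) ≡ c * wsum wt xs
wsum-map c p []       = sym (ℤ.*-zeroʳ c)
wsum-map c p (x ∷ xs) = trans (cong₂ _+_ (p x) (wsum-map c p xs)) (sym (ℤ.*-distribˡ-+ c _ _))

pairWeight : {X Y : Set} → (X → ℤ) → (Y → ℤ) → X × Y → ℤ
pairWeight wt wt′ (x , y) = wt x * wt′ y

wsum-× : ∀ {X Y : Set} (wt : X → ℤ) (wt′ : Y → ℤ) xs ys →
         wsum (pairWeight wt wt′) (cartesianProduct xs ys) ≡ wsum wt xs * wsum wt′ ys
wsum-× wt wt′ []       ys = sym (ℤ.*-zeroˡ (wsum wt′ ys))
wsum-× wt wt′ (x ∷ xs) ys = begin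
  wsum (pairWeight wt wt′) (map (x ,_) ys ++ cartesianProduct xs ys)
    ≡⟨ wsum-++ _ (map (x ,_) ys) _ ⟩
  wsum (pairWeight wt wt′) (map (x ,_) ys) + wsum (pairWeight wt wt′) (cartesianProduct xs ys)
    ≡⟨ cong₂ _+_ (wsum-map (wt x) (λ _ → refl) ys) (wsum-× wt wt′ xs ys) ⟩
  wt x * wsum wt′ ys + wsum wt xs * wsum wt′ ys
    ≡⟨ ℤ.*-distribʳ-+ (wsum wt′ ys) (wt x) _ ⟨
  (wt x + wsum wt xs) * wsum wt′ ys ∎
  where open ≡-Reasoning

-- A weighted form of `HasCount`: weights 1 give the number of elements, weights ±1 a difference of
-- two numbers.
record Total {X : Set} (wt : X → ℤ) (P : X → Set) (c : ℤ) : Set where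
  constructor total
  field
    list   : List X
    unique : Unique list
    member : ∀ x → P x ⇔ (x ∈ list)
    value  : wsum wt list ≡ c

filter-member : ∀ {X : Set} {P Q : X → Set} {xs} (Q? : Decidable Q) → (∀ x → P x ⇔ (x ∈ xs)) →
                ∀ x → (P x × Q x) ⇔ (x ∈ filter Q? xs)
filter-member Q? xs∋ x = mk⇔
  (λ (px , qx) → ∈-filter⁺ Q? (to (xs∋ x) px) qx)
  (λ x∈ → let x∈xs , qx = ∈-filter⁻ Q? x∈ in from (xs∋ x) x∈xs , qx)

module _ {X : Set} {wt : X → ℤ} where

  -- Two duplicate-free lists with the same elements are permutations of each other. Every
  -- functional equation below arises by totalling one class in two ways.
  Total-unique : ∀ {P : X → Set} {c d} → Total wt P c → Total wt P d → c ≡ d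
  Total-unique (total xs xs! xs∋ p) (total ys ys! ys∋ r) =
    trans (sym p) (trans (wsum-↭ wt (∼bag⇒↭ (unique∧set⇒bag xs! ys! (λ {x} → ⇔-trans (⇔-sym (xs∋ x)) (ys∋ x))))) r)

  Total-⇔ : ∀ {P Q : X → Set} {c} → (∀ x → P x ⇔ Q x) → Total wt P c → Total wt Q c
  Total-⇔ P⇔Q (total xs xs! xs∋ p) = total xs xs! (λ x → ⇔-trans (⇔-sym (P⇔Q x)) (xs∋ x)) p

  Total-∅ : ∀ {P : X → Set} → (∀ x → ¬ P x) → Total wt P (+ 0)
  Total-∅ ¬P = total [] [] (λ x → mk⇔ (λ px → contradiction px (¬P x)) λ ()) refl

  Total-singleton : ∀ {P : X → Set} x → (∀ y → P y ⇔ (y ≡ x)) → Total wt P (wt x)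
  Total-singleton x P⇔ = total [ x ] ([] ∷ [])
    (λ y → ⇔-trans (P⇔ y) (mk⇔ here λ { (here y≡x) → y≡x ; (there ()) })) (ℤ.+-identityʳ (wt x))

  Total-⊎ : ∀ {P Q : X → Set} {c d} → (∀ x → P x → ¬ Q x) →
            Total wt P c → Total wt Q d → Total wt (λ x → P x ⊎ Q x) (c + d)
  Total-⊎ disjoint (total xs xs! xs∋ p) (total ys ys! ys∋ r) = total (xs ++ ys)
    (Unique.++⁺ xs! ys! λ { {x} (x∈xs , x∈ys) → disjoint x (from (xs∋ x) x∈xs) (from (ys∋ x) x∈ys) })
    (λ x → mk⇔ [ ∈-++⁺ˡ ∘ to (xs∋ x) , ∈-++⁺ʳ xs ∘ to (ys∋ x) ]′
               ([ inj₁ ∘ from (xs∋ x) , inj₂ ∘ from (ys∋ x) ]′ ∘ ∈-++⁻ xs))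
    (trans (wsum-++ wt xs ys) (cong₂ _+_ p r))

  Total-filter : ∀ {P Q : X → Set} {c} → Decidable Q → Total wt P c →
                 Σ ℤ (Total wt (λ x → P x × Q x))
  Total-filter Q? (total xs xs! xs∋ p) = _ , total (filter Q? xs) (Unique.filter⁺ Q? xs!)
    (filter-member Q? xs∋) refl

Image : {X Y : Set} → (X → Y) → (X → Set) → Y → Set
Image φ P y = ∃ λ x → P x × y ≡ φ x

Total-map : ∀ {X Y : Set} {wt : X → ℤ} {wt′ : Y → ℤ} {P : X → Set} {c d} (φ : X → Y) →
            (∀ {x y} → φ x ≡ φ y → x ≡ y) → (∀ x → wt′ (φ x) ≡ d * wt x) →
            Total wt P c → Total wt′ (Image φ P) (d * c)
Total-map {d = d} φ inj scales (total xs xs! xs∋ refl) = total (map φ xs) (Unique.map⁺ inj xs!)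
  (λ y → mk⇔ (λ { (x , px , refl) → ∈-map⁺ φ (to (xs∋ x) px) })
             (λ y∈ → let x , x∈xs , y≡φx = ∈-map⁻ φ y∈ in x , from (xs∋ x) x∈xs , y≡φx))
  (wsum-map d scales xs)

Total-× : ∀ {X Y : Set} {wt : X → ℤ} {wt′ : Y → ℤ} {P : X → Set} {Q : Y → Set} {c d} →
          Total wt P c → Total wt′ Q d → Total (pairWeight wt wt′) (λ (x , y) → P x × Q y) (c * d)
Total-× {wt = wt} {wt′} (total xs xs! xs∋ refl) (total ys ys! ys∋ refl) =
  total (cartesianProduct xs ys) (Unique.cartesianProduct⁺ xs! ys!)
    (λ (x , y) → mk⇔ (λ (px , qy) → ∈-cartesianProduct⁺ (to (xs∋ x) px) (to (ys∋ y) qy))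
                     (λ xy∈ → let x∈ , y∈ = ∈-cartesianProduct⁻ xs ys xy∈ in from (xs∋ x) x∈ , from (ys∋ y) y∈))
    (wsum-× wt wt′ xs ys)

HasGF : {X : Set} → (X → ℕ) → (X → ℤ) → (X → Set) → Series → Set
HasGF size wt P F = ∀ n → Total wt (λ x → P x × size x ≡ n) (F n)

module _ {X : Set} {size : X → ℕ} {wt : X → ℤ} where

  HasGF-unique : ∀ {P : X → Set} {F G} → HasGF size wt P F → HasGF size wt P G → F ≈ₛ G
  HasGF-unique p r n = Total-unique (p n) (r n)

  HasGF-⇔ : ∀ {P Q : X → Set} {F} → (∀ x → P x ⇔ Q x) → HasGF size wt P F → HasGF size wt Q F
  HasGF-⇔ P⇔Q p n = Total-⇔
    (λ x → mk⇔ (λ (px , e) → to (P⇔Q x) px , e) (λ (qx , e) → from (P⇔Q x) qx , e)) (p n)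

  HasGF-⊎ : ∀ {P Q : X → Set} {F G} → (∀ x → P x → ¬ Q x) →
            HasGF size wt P F → HasGF size wt Q G → HasGF size wt (λ x → P x ⊎ Q x) (F +ₛ G)
  HasGF-⊎ disjoint p r n = Total-⇔
    (λ x → mk⇔ (λ { (inj₁ (px , e)) → inj₁ px , e ; (inj₂ (qx , e)) → inj₂ qx , e })
               (λ { (inj₁ px , e) → inj₁ (px , e) ; (inj₂ qx , e) → inj₂ (qx , e) }))
    (Total-⊎ (λ x (px , _) (qx , _) → disjoint x px qx) (p n) (r n))

  HasGF-filter : ∀ {P Q : X → Set} {F} → Decidable Q → HasGF size wt P F →
                 Σ Series (HasGF size wt (λ x → P x × Q x))
  HasGF-filter Q? p = (λ n → proj₁ (filtered n)) , λ n → Total-⇔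
    (λ x → mk⇔ (λ ((px , e) , qx) → (px , qx) , e) (λ ((px , qx) , e) → (px , e) , qx))
    (proj₂ (filtered n))
    where filtered = λ n → Total-filter Q? (p n)

module _ {X Y : Set} {size : X → ℕ} {size′ : Y → ℕ} {wt : X → ℤ} {wt′ : Y → ℤ} where

  Total-shift : ∀ {P : X → Set} {c d k n} (φ : X → Y) → (∀ {x y} → φ x ≡ φ y → x ≡ y) →
                (∀ x → size′ (φ x) ≡ k ℕ.+ size x) → (∀ x → wt′ (φ x) ≡ d * wt x) →
                Total wt (λ x → P x × size x ≡ n) c →
                Total wt′ (λ y → Image φ P y × size′ y ≡ k ℕ.+ n) (d * c)
  Total-shift {d = d} {k} {n} φ inj grows scales p = Total-⇔
    (λ y → mk⇔ (λ { (x , (px , refl) , refl) → (x , px , refl) , grows x })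
               (λ { ((x , px , refl) , e) → x , (px , ℕ.+-cancelˡ-≡ k _ _ (trans (sym (grows x)) e)) , refl }))
    (Total-map {d = d} φ inj scales p)

  HasGF-shift : ∀ {P : X → Set} {F d k} (φ : X → Y) → (∀ {x y} → φ x ≡ φ y → x ≡ y) →
                (∀ x → size′ (φ x) ≡ k ℕ.+ size x) → (∀ x → wt′ (φ x) ≡ d * wt x) →
                HasGF size wt P F → HasGF size′ wt′ (Image φ P) (mono d k *ₛ F)
  HasGF-shift {P} {F} {d} {k} φ inj grows scales p n with ℕ.≤-<-connex k n
  ... | inj₂ n<k = subst (Total wt′ _) (sym (mono-*-< d F n<k)) (Total-∅
    λ { y ((x , _ , refl) , e) → ℕ.<⇒≱ n<k (ℕ.≤-trans (ℕ.m≤m+n k (size x)) (ℕ.≤-reflexive (trans (sym (grows x)) e))) })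
  ... | inj₁ k≤n with n ∸ k | ℕ.m+[n∸m]≡n k≤n
  ... | r | refl = subst (Total wt′ _) (sym (mono-*-+ d F k r)) (Total-shift {d = d} φ inj grows scales (p r))

  HasGF-× : ∀ {P : X → Set} {Q : Y → Set} {F G} → HasGF size wt P F → HasGF size′ wt′ Q G →
            HasGF (λ (x , y) → size x ℕ.+ size′ y) (pairWeight wt wt′) (λ (x , y) → P x × Q y) (F *ₛ G)
  HasGF-× {P} {Q} {F} {G} p r n = Total-⇔ {P = Bounded n}
    (λ (x , y) → mk⇔
      (λ (px , qy , x≤n , e) → (px , qy) , trans (cong (size x ℕ.+_) e) (ℕ.m+[n∸m]≡n x≤n))
      (λ ((px , qy) , e) → px , qy , ℕ.m+n≤o⇒m≤o (size x) (ℕ.≤-reflexive e)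
                         , trans (sym (ℕ.m+n∸m≡n (size x) (size′ y))) (cong (_∸ size x) e)))
    (upTo n)
    where
    -- The convolution sum recurses on its upper limit while `n` stays fixed, so the induction
    -- bounds the size of the first component by `k`. For k = n the bound makes the monus a true
    -- subtraction.
    Bounded : ℕ → X × Y → Set
    Bounded k (x , y) = P x × Q y × size x ≤ k × size′ y ≡ n ∸ size x
    upTo : ∀ k → Total (pairWeight wt wt′) (Bounded k) (sumTo k (λ i → F i * G (n ∸ i)))
    upTo zero    = Total-⇔
      (λ (x , y) → mk⇔ (λ { ((px , e) , (qy , e′)) → px , qy , ℕ.≤-reflexive e , trans e′ (cong (n ∸_) (sym e)) })
                       (λ { (px , qy , x≤0 , e) → (px , ℕ.n≤0⇒n≡0 x≤0) , (qy , trans e (cong (n ∸_) (ℕ.n≤0⇒n≡0 x≤0))) }))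
      (Total-× (p 0) (r n))
    upTo (suc k) = Total-⇔
      (λ (x , y) → mk⇔
        (λ { (inj₁ (px , qy , x≤k , e)) → px , qy , ℕ.m≤n⇒m≤1+n x≤k , e
           ; (inj₂ ((px , e) , (qy , e′))) → px , qy , ℕ.≤-reflexive e , trans e′ (cong (n ∸_) (sym e)) })
        (λ { (px , qy , x≤sk , e) → split px qy e (ℕ.m≤n⇒m<n∨m≡n x≤sk) }))
      (Total-⊎ (λ { (x , y) (_ , _ , x≤k , _) ((_ , e) , _) → ℕ.1+n≰n (ℕ.≤-trans (ℕ.≤-reflexive (sym e)) x≤k) })
        (upTo k) (Total-× (p (suc k)) (r (n ∸ suc k))))
      where
      split : ∀ {x y} → P x → Q y → size′ y ≡ n ∸ size x → size x < suc k ⊎ size x ≡ suc k →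
              Bounded k (x , y) ⊎ ((P x × size x ≡ suc k) × (Q y × size′ y ≡ n ∸ suc k))
      split px qy e (inj₁ (s≤s x≤k)) = inj₁ (px , qy , x≤k , e)
      split px qy e (inj₂ x≡sk)      = inj₂ ((px , x≡sk) , (qy , trans e (cong (n ∸_) x≡sk)))

-- One-colour lists

even⇒odd-suc : ∀ {x} → Even x → Odd (suc x)
even⇒odd-suc {x} 2∣x 2∣1+x = contradiction (∣1⇒≡1 (∣m+n∣m⇒∣n (subst (2 ∣_) (ℕ.+-comm 1 x) 2∣1+x) 2∣x)) λ ()

odd⇒even-suc : ∀ x → Odd x → Even (suc x)
odd⇒even-suc zero          odd = contradiction (divides 0 refl) odd
odd⇒even-suc (suc zero)    odd = ∣-refl
odd⇒even-suc (suc (suc x)) odd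
  with odd⇒even-suc x (λ { (divides q e) → odd (divides (suc q) (cong (suc ∘ suc) e)) })
... | divides q e = divides (suc q) (cong (suc ∘ suc) e)

even-double : ∀ k → Even (k ℕ.* 2)
even-double k = divides k refl

odd⇒double : ∀ s → Odd s → ∃ λ k → s ≡ suc (k ℕ.* 2)
odd⇒double s odd with odd⇒even-suc s odd
... | divides (suc k) e = k , ℕ.suc-injective e

module _ {A : Set} {R : A → A → Set} where

  AllPairs-∷ʳ⁺ : ∀ {xs y} → AllPairs R xs → All (λ x → R x y) xs → AllPairs R (xs ∷ʳ y)
  AllPairs-∷ʳ⁺ pxs pys = AllPairs.++⁺ pxs ([] ∷ []) (All.map (_∷ []) pys)

  AllPairs-∷ʳ⁻ : ∀ xs {y} → AllPairs R (xs ∷ʳ y) → AllPairs R xs × All (λ x → R x y) xs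
  AllPairs-∷ʳ⁻ []       _         = [] , []
  AllPairs-∷ʳ⁻ (x ∷ xs) (px ∷ ps) =
    let qx , rx = All.∷ʳ⁻ px
        qs , rs = AllPairs-∷ʳ⁻ xs ps
    in qx ∷ qs , rx ∷ rs

OneColor : ℕ → List ℕ → Set
OneColor lo b = AllPairs _≥_ b × All (lo ≤_) b × AllPairs (λ x y → Even x → x ≢ y) b

OneColor-lower : ∀ {l m} → l ≤ m → ∀ {b} → OneColor m b → OneColor l b
OneColor-lower l≤m (dec , ≥m , dist) = dec , All.map (ℕ.≤-trans l≤m) ≥m , dist

OneColor-∷ʳ⁺ : ∀ {l b} → (Even l → All (l ≢_) b) → OneColor l b → OneColor l (b ∷ʳ l)
OneColor-∷ʳ⁺ new (dec , ≥l , dist) =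
  AllPairs-∷ʳ⁺ dec ≥l , All.∷ʳ⁺ ≥l ℕ.≤-refl ,
  AllPairs-∷ʳ⁺ dist (All.tabulate λ { {y} y∈b even refl → All.lookup (new even) y∈b refl })

OneColor-∷ʳ⁻ : ∀ {l} b → OneColor l (b ∷ʳ l) → OneColor l b × (Even l → All (l ≢_) b)
OneColor-∷ʳ⁻ b (dec , ≥l , dist) =
  let dec′ , _ = AllPairs-∷ʳ⁻ b dec
      dist′ , new = AllPairs-∷ʳ⁻ b dist
  in (dec′ , proj₁ (All.∷ʳ⁻ ≥l) , dist′) , λ even → All.map (λ { p refl → p even refl }) new

OneColor-raise : ∀ {l b} → All (l ≢_) b → OneColor l b → OneColor (suc l) b
OneColor-raise {l} l∉b (dec , ≥l , dist) =
  dec , All.zipWith (λ (l≤x , l≢x) → ℕ.≤∧≢⇒< l≤x l≢x) (≥l , l∉b) , dist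

-- In a decreasing list the last entry decides: if it exceeds `l`, so do all the others.
OneColor-split : ∀ {l b} → OneColor l b → OneColor (suc l) b ⊎ ∃ λ b′ → b ≡ b′ ∷ʳ l
OneColor-split {l} {b} (dec , ≥l , dist) with initLast b
... | []       = inj₁ ([] , [] , [])
... | b′ ∷ʳ′ x with ℕ.m≤n⇒m<n∨m≡n (proj₂ (All.∷ʳ⁻ ≥l))
...   | inj₂ refl = inj₂ (b′ , refl)
...   | inj₁ l<x  = inj₁ (dec , All.∷ʳ⁺ (All.map (ℕ.≤-trans l<x) (proj₂ (AllPairs-∷ʳ⁻ b′ dec))) l<x , dist)

Snoc : ℕ → (List ℕ → Set) → List ℕ → Set
Snoc l = Image (_∷ʳ l)

∉-OneColor-suc : ∀ {l b} → OneColor (suc l) b → l ∉ b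
∉-OneColor-suc (_ , >l , _) l∈b = ℕ.1+n≰n (All.lookup >l l∈b)

last-∈ : ∀ {l : ℕ} b → l ∈ b ∷ʳ l
last-∈ b = ∈-++⁺ʳ b (here refl)

-- The parity of `l` enters only through `last⇔`: once a copy of `l` is removed, more copies may
-- remain if `l` is odd, and none if it is even.
OneColor-⇔ : ∀ {l} {P : List ℕ → Set} → (∀ b → OneColor l (b ∷ʳ l) ⇔ P b) →
             ∀ b → (OneColor (suc l) b ⊎ Snoc l P b) ⇔ OneColor l b
OneColor-⇔ {l} {P} last⇔ b = mk⇔
  (λ { (inj₁ p) → OneColor-lower (ℕ.n≤1+n l) p ; (inj₂ (b′ , p , refl)) → from (last⇔ b′) p })
  (λ p → split p (OneColor-split p))
  where
  split : ∀ {b} → OneColor l b → OneColor (suc l) b ⊎ ∃ (λ b′ → b ≡ b′ ∷ʳ l) → OneColor (suc l) b ⊎ Snoc l P b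
  split p (inj₁ q)           = inj₁ q
  split p (inj₂ (b′ , refl)) = inj₂ (b′ , to (last⇔ b′) p , refl)

OneColor-disjoint : ∀ {l P} b → OneColor (suc l) b → ¬ Snoc l P b
OneColor-disjoint b p (b′ , _ , refl) = ∉-OneColor-suc p (last-∈ b′)

OneColor-odd : ∀ {l} → Odd l → ∀ b → OneColor l (b ∷ʳ l) ⇔ OneColor l b
OneColor-odd odd b = mk⇔ (proj₁ ∘ OneColor-∷ʳ⁻ b) (OneColor-∷ʳ⁺ (λ even → contradiction even odd))

OneColor-even : ∀ {l} → Even l → ∀ b → OneColor l (b ∷ʳ l) ⇔ OneColor (suc l) b
OneColor-even {l} even b = mk⇔
  (λ p → let q , new = OneColor-∷ʳ⁻ b p in OneColor-raise (new even) q)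
  (λ p → OneColor-∷ʳ⁺ (λ _ → All.map ℕ.<⇒≢ (proj₁ (proj₂ p))) (OneColor-lower (ℕ.n≤1+n l) p))

-- For odd `s` the only even number from s to s + 2 is s + 1, so forbidding that single part
-- expresses that blue even parts are at least s + 3.
Blue : ℕ → List ℕ → Set
Blue s b = OneColor s b × s ∈ b × suc s ∉ b

-- After one `s` is removed, either another remains and the list is of the same kind, or none does;
-- in the latter case s and s + 1 are both absent and the parts are at least s + 2.
Blue-⇔ : ∀ {s} → Odd s → ∀ b → Snoc s (λ b′ → OneColor (2 ℕ.+ s) b′ ⊎ Blue s b′) b ⇔ Blue s b
Blue-⇔ {s} odd b = mk⇔ build (λ p → split p (OneColor-split (proj₁ p)))
  where
  avoids : ∀ {b′} → suc s ∉ b′ → suc s ∉ b′ ∷ʳ s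
  avoids {b′} s∉b′ s∈ with ∈-++⁻ b′ s∈
  ... | inj₁ s∈b′     = s∉b′ s∈b′
  ... | inj₂ (here e) = ℕ.1+n≢n e
  build : ∀ {b} → Snoc s (λ b′ → OneColor (2 ℕ.+ s) b′ ⊎ Blue s b′) b → Blue s b
  build (b′ , inj₁ p , refl) = from (OneColor-odd odd b′) (OneColor-lower (ℕ.m≤n+m s 2) p)
                             , last-∈ b′ , avoids (∉-OneColor-suc p)
  build (b′ , inj₂ (p , _ , s∉b′) , refl) = from (OneColor-odd odd b′) p , last-∈ b′ , avoids s∉b′
  inner : ∀ {b′} → OneColor s b′ → suc s ∉ b′ → OneColor (suc s) b′ ⊎ ∃ (λ b″ → b′ ≡ b″ ∷ʳ s) →
          OneColor (2 ℕ.+ s) b′ ⊎ Blue s b′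
  inner p s∉b′ (inj₁ q)           = inj₁ (OneColor-raise (All.tabulate λ { x∈ refl → s∉b′ x∈ }) q)
  inner p s∉b′ (inj₂ (b″ , refl)) = inj₂ (p , last-∈ b″ , s∉b′)
  split : ∀ {b} → Blue s b → OneColor (suc s) b ⊎ ∃ (λ b′ → b ≡ b′ ∷ʳ s) →
          Snoc s (λ b′ → OneColor (2 ℕ.+ s) b′ ⊎ Blue s b′) b
  split (_ , s∈b , _)  (inj₁ q) = contradiction s∈b (∉-OneColor-suc q)
  split (p , _ , s∉b)  (inj₂ (b′ , refl)) =
    let p′ = to (OneColor-odd odd b′) p in b′ , inner p′ (s∉b ∘ ∈-++⁺ˡ) (OneColor-split p′) , refl

Blue-disjoint : ∀ {s} b → OneColor (2 ℕ.+ s) b → ¬ Blue s b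
Blue-disjoint b p (_ , s∈b , _) = ∉-OneColor-suc (OneColor-lower (ℕ.n≤1+n _) p) s∈b

sum-∷ʳ : ∀ l b → sum (b ∷ʳ l) ≡ l ℕ.+ sum b
sum-∷ʳ l b = trans (sum-++ b [ l ]) (trans (cong (sum b ℕ.+_) (ℕ.+-identityʳ l)) (ℕ.+-comm (sum b) l))

∷ʳ-inj : ∀ l {b b′ : List ℕ} → b ∷ʳ l ≡ b′ ∷ʳ l → b ≡ b′
∷ʳ-inj l = ∷ʳ-injectiveˡ _ _

module _ (w : ℤ) where

  weight : List ℕ → ℤ
  weight b = w ^ length (filter (2 ∣?_) b)

  weight-++ : ∀ b g → weight (b ++ g) ≡ weight b * weight g
  weight-++ b g = begin
    w ^ length (filter (2 ∣?_) (b ++ g))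
      ≡⟨ cong (λ z → w ^ length z) (filter-++ (2 ∣?_) b g) ⟩
    w ^ length (filter (2 ∣?_) b ++ filter (2 ∣?_) g)
      ≡⟨ cong (w ^_) (length-++ (filter (2 ∣?_) b)) ⟩
    w ^ (length (filter (2 ∣?_) b) ℕ.+ length (filter (2 ∣?_) g))
      ≡⟨ ℤ.^-distribˡ-+-* w (length (filter (2 ∣?_) b)) _ ⟩
    weight b * weight g ∎
    where open ≡-Reasoning

  weight-even : ∀ {l} → Even l → ∀ b → weight (b ∷ʳ l) ≡ w * weight b
  weight-even {l} even b = trans (weight-++ b [ l ])
    (trans (cong (weight b *_) (trans (cong (λ z → w ^ length z) (filter-accept (2 ∣?_) {xs = []} even)) (ℤ.*-identityʳ w)))
           (ℤ.*-comm (weight b) w))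

  weight-odd : ∀ {l} → Odd l → ∀ b → weight (b ∷ʳ l) ≡ + 1 * weight b
  weight-odd {l} odd b = trans (weight-++ b [ l ])
    (trans (cong (weight b *_) (cong (λ z → w ^ length z) (filter-reject (2 ∣?_) {xs = []} odd)))
           (ℤ.*-comm (weight b) (+ 1)))

  OneColor-base : ∀ {l n} → n < l → Σ ℤ (Total weight (λ b → OneColor l b × sum b ≡ n))
  OneColor-base {l} {zero}  0<l = _ , Total-singleton [] λ
    { []      → mk⇔ (λ _ → refl) (λ _ → ([] , [] , []) , refl)
    ; (x ∷ b) → mk⇔ (λ { ((_ , l≤x ∷ _ , _) , e) →
        contradiction (ℕ.≤-trans l≤x (ℕ.≤-trans (ℕ.m≤m+n x (sum b)) (ℕ.≤-reflexive e))) (ℕ.<⇒≱ 0<l) }) λ () }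
  OneColor-base {l} {suc n} n<l = _ , Total-∅ λ
    { (x ∷ b) ((_ , l≤x ∷ _ , _) , e) →
        contradiction (ℕ.≤-trans l≤x (ℕ.≤-trans (ℕ.m≤m+n x (sum b)) (ℕ.≤-reflexive e))) (ℕ.<⇒≱ n<l) }

  -- The recursion is on `d`, an allowance for the gap between the bound `l` and the sum `n`.
  -- Raising the bound by one spends one unit of `d`; removing a part `l` also pays for one unit,
  -- because 1 ≤ l makes the sum drop. When `l` exceeds the sum, only the empty list can occur.
  OneColor-total : ∀ d l n → 1 ≤ l → n < d ℕ.+ l → Σ ℤ (Total weight (λ b → OneColor l b × sum b ≡ n))
  OneColor-total zero    l n 1≤l n<l = OneColor-base n<l
  OneColor-total (suc d) l n 1≤l n<  with ℕ.≤-<-connex l n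
  ... | inj₂ n<l = OneColor-base n<l
  ... | inj₁ l≤n with n ∸ l | ℕ.m+[n∸m]≡n l≤n
  ... | r | refl = byParity (2 ∣? l)
    where
    r< : r < d ℕ.+ l
    r< = ℕ.≤-trans (ℕ.+-monoˡ-≤ r 1≤l) (ℕ.s≤s⁻¹ n<)
    n<′ : l ℕ.+ r < d ℕ.+ suc l
    n<′ = subst (l ℕ.+ r <_) (sym (ℕ.+-suc d l)) n<

    extend : ∀ P c → (∀ b → OneColor l (b ∷ʳ l) ⇔ P b) → (∀ b → weight (b ∷ʳ l) ≡ c * weight b) →
             Σ ℤ (Total weight (λ b → P b × sum b ≡ r)) →
             Σ ℤ (Total weight (λ b → OneColor l b × sum b ≡ l ℕ.+ r))
    extend P c last⇔ scales (_ , p) = _ , Total-⇔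
      (λ b → mk⇔ (λ { (inj₁ (p , e)) → to (OneColor-⇔ last⇔ b) (inj₁ p) , e
                    ; (inj₂ (p , e)) → to (OneColor-⇔ last⇔ b) (inj₂ p) , e })
                 (λ (p , e) → [ (λ q → inj₁ (q , e)) , (λ q → inj₂ (q , e)) ]′ (from (OneColor-⇔ last⇔ b) p)))
      (Total-⊎ (λ b (p , _) (q , _) → OneColor-disjoint {P = P} b p q)
        (proj₂ (OneColor-total d (suc l) (l ℕ.+ r) (s≤s z≤n) n<′))
        (Total-shift {size = sum} {size′ = sum} {d = c} (_∷ʳ l) (∷ʳ-inj l) (sum-∷ʳ l) scales p))

    byParity : Dec (Even l) → Σ ℤ (Total weight (λ b → OneColor l b × sum b ≡ l ℕ.+ r))
    byParity (yes even) = extend (OneColor (suc l)) w (OneColor-even even) (weight-even even)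
      (OneColor-total d (suc l) r (s≤s z≤n) (ℕ.≤-trans r< (ℕ.+-monoʳ-≤ d (ℕ.n≤1+n l))))
    byParity (no odd)   = extend (OneColor l) (+ 1) (OneColor-odd odd) (weight-odd odd) (OneColor-total d l r 1≤l r<)

  -- The index is shifted by one: the bound on the parts is suc l, since OneColor-total needs it to be positive.
  oneColor : ℕ → Series
  oneColor l n = proj₁ (OneColor-total (suc n) (suc l) n (s≤s z≤n) (s≤s (ℕ.m≤m+n n (suc l))))

  oneColor-GF : ∀ l → HasGF sum weight (OneColor (suc l)) (oneColor l)
  oneColor-GF l n = proj₂ (OneColor-total (suc n) (suc l) n (s≤s z≤n) (s≤s (ℕ.m≤m+n n (suc l))))

  Snoc-GF : ∀ {l P F} c → (∀ b → weight (b ∷ʳ l) ≡ c * weight b) → HasGF sum weight P F →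
            HasGF sum weight (Snoc l P) (mono c l *ₛ F)
  Snoc-GF {l} c = HasGF-shift (_∷ʳ l) (∷ʳ-inj l) (sum-∷ʳ l)

  oneColor-odd : ∀ l → Odd (suc l) → oneColor l ≈ₛ (oneColor (suc l) +ₛ (mono (+ 1) (suc l) *ₛ oneColor l))
  oneColor-odd l odd = HasGF-unique (oneColor-GF l)
    (HasGF-⇔ (OneColor-⇔ (OneColor-odd odd))
      (HasGF-⊎ OneColor-disjoint (oneColor-GF (suc l)) (Snoc-GF (+ 1) (weight-odd odd) (oneColor-GF l))))

  oneColor-even : ∀ l → Even (suc l) → oneColor l ≈ₛ (oneColor (suc l) +ₛ (mono w (suc l) *ₛ oneColor (suc l)))
  oneColor-even l even = HasGF-unique (oneColor-GF l)
    (HasGF-⇔ (OneColor-⇔ (OneColor-even even))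
      (HasGF-⊎ OneColor-disjoint (oneColor-GF (suc l)) (Snoc-GF w (weight-even even) (oneColor-GF (suc l)))))

  -- A nonempty list with all parts above `l` has sum above `l`, so up to that degree only the empty
  -- list counts. This is the limit v(s) → 1 in exact form.
  oneColor-truncated : ∀ {l n} → n ≤ l → oneColor l n ≡ oneₛ n
  oneColor-truncated {l} {zero} n≤l = Total-unique (oneColor-GF l 0) (proj₂ (OneColor-base {suc l} {0} (s≤s n≤l)))
  oneColor-truncated {l} {suc n} n≤l = Total-unique (oneColor-GF l (suc n)) (proj₂ (OneColor-base {suc l} {suc n} (s≤s n≤l)))

  -- Mere existence of the coefficients suffices here: the recurrence `blue-odd` determines the
  -- series.
  blue-filtered : ∀ l → Σ Series (HasGF sum weight (Blue (suc l)))
  blue-filtered l = HasGF-filter (λ b → (suc l ∈ℕ? b) ×-dec ¬? (suc (suc l) ∈ℕ? b)) (oneColor-GF l)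
    where
    _∈ℕ?_ = _∈?_ ℕ._≟_

  blue : ℕ → Series
  blue l = proj₁ (blue-filtered l)

  blue-GF : ∀ l → HasGF sum weight (Blue (suc l)) (blue l)
  blue-GF l = proj₂ (blue-filtered l)

  blue-odd : ∀ l → Odd (suc l) → blue l ≈ₛ (mono (+ 1) (suc l) *ₛ (oneColor (suc (suc l)) +ₛ blue l))
  blue-odd l odd = HasGF-unique (blue-GF l)
    (HasGF-⇔ (Blue-⇔ odd) (Snoc-GF (+ 1) (weight-odd odd)
      (HasGF-⊎ Blue-disjoint (oneColor-GF (suc (suc l))) (blue-GF l))))

-- The telescoping sum

blueGreen : ℤ → ℕ → Series
blueGreen w k = blue w (k ℕ.* 2) *ₛ oneColor w (k ℕ.* 2)

∑blueGreen : ℤ → ℕ → Series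
∑blueGreen w zero    = zeroₛ
∑blueGreen w (suc k) = ∑blueGreen w k +ₛ blueGreen w k

-- The finite product (q;q²)_k, which collects the factors 1 - x met on the way from v(1) to
-- v(2k+1).
oddPoch : ℕ → Series
oddPoch zero    = oneₛ
oddPoch (suc k) = oddPoch k *ₛ (oneₛ +ₛ (-ₛ mono (+ 1) (suc (k ℕ.* 2))))

-- The finite product (q²;q²)_k, an auxiliary cofactor for Euler's identity.
evenPoch : ℕ → Series
evenPoch zero    = oneₛ
evenPoch (suc k) = evenPoch k *ₛ (oneₛ +ₛ (-ₛ mono (+ 1) (suc k ℕ.* 2)))

oddPoch-0 : ∀ k → oddPoch k 0 ≡ + 1
oddPoch-0 zero    = refl
oddPoch-0 (suc k) = cong (λ z → z * (+ 1)) (oddPoch-0 k)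

evenPoch-0 : ∀ k → evenPoch k 0 ≡ + 1
evenPoch-0 zero    = refl
evenPoch-0 (suc k) = cong (λ z → z * (+ 1)) (evenPoch-0 k)

module Identities (n : ℕ) where
  open Truncated n
  open Solver using (solve; _:=_; _:+_; _:*_; _:-_; con)
  open Relation.Binary.Reasoning.Setoid setoid

  zeroₛ≈ : zeroₛ ≈ mono (+ 0) 0
  zeroₛ≈ = mk λ { {zero} _ → refl ; {suc m} _ → refl }

  mono-≈ : ∀ c {k l} → k ≡ l → mono c k ≈ mono c l
  mono-≈ c refl = ≈-refl

  mono-> : ∀ c {k} → n < k → mono c k ≈ mono (+ 0) 0
  mono-> c {k} n<k = ≈-trans (mk λ {m} m≤n → mono-≢ c {k} {m} λ { refl → ℕ.<⇒≱ n<k m≤n }) zeroₛ≈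

  oneColor-≈1 : ∀ w {l} → n ≤ l → oneColor w l ≈ oneₛ
  oneColor-≈1 w {l} n≤l = mk λ m≤n → oneColor-truncated w (ℕ.≤-trans m≤n n≤l)

  q : Series
  q = mono (+ 1) 1

  x : ℕ → Series
  x k = mono (+ 1) (suc (k ℕ.* 2))

  module Weighted (w : ℤ) (w²≡1 : w * w ≡ + 1) where

    p : Series
    p = mono w 1

    v : ℕ → Series
    v k = oneColor w (k ℕ.* 2)

    px : ∀ k → mono w (suc (suc (k ℕ.* 2))) ≈ p *ₛ x k
    px k = ≈-sym (≈-trans (≈⇒Agree (mono-*-mono w 1 (+ 1) (suc (k ℕ.* 2))))
      (≈-reflexive (cong (λ c → mono c (suc (suc (k ℕ.* 2)))) (ℤ.*-identityʳ w))))

    -- Here w² = 1 enters: q² = p², so the passage from s to s + 2 sends x to p² x, and the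
    -- telescoping becomes a polynomial identity in p and x.
    ppx : ∀ k → x (suc k) ≈ p *ₛ (p *ₛ x k)
    ppx k = ≈-sym (≈-trans (*-congˡ p (≈-sym (px k)))
      (≈-trans (≈⇒Agree (mono-*-mono w 1 w (suc (suc (k ℕ.* 2)))))
        (≈-reflexive (cong (λ c → mono c (suc (suc (suc (k ℕ.* 2))))) w²≡1))))

    -- Two single steps are composed: the odd bound s contributes the factor 1 - x on the left, the
    -- even bound s + 1 the factor 1 + w q^(s+1) = 1 + p x on the right.
    v-step : ∀ k → (oneₛ +ₛ (-ₛ x k)) *ₛ v k ≈ (oneₛ +ₛ p *ₛ x k) *ₛ v (suc k)
    v-step k = begin
      (oneₛ +ₛ (-ₛ x k)) *ₛ v k
        ≈⟨ solve 2 (λ x v → (con (+ 1) :- x) :* v := v :- x :* v) ≈-refl (x k) (v k) ⟩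
      v k +ₛ (-ₛ (x k *ₛ v k))
        ≈⟨ +-congʳ (-ₛ (x k *ₛ v k)) (≈⇒Agree (oneColor-odd w (k ℕ.* 2) (even⇒odd-suc (even-double k)))) ⟩
      (u +ₛ x k *ₛ v k) +ₛ (-ₛ (x k *ₛ v k))
        ≈⟨ solve 2 (λ u y → (u :+ y) :- y := u) ≈-refl u (x k *ₛ v k) ⟩
      u
        ≈⟨ ≈⇒Agree (oneColor-even w (suc (k ℕ.* 2)) (even-double (suc k))) ⟩
      v (suc k) +ₛ mono w (suc (suc (k ℕ.* 2))) *ₛ v (suc k)
        ≈⟨ +-congˡ (v (suc k)) (*-congʳ (v (suc k)) (px k)) ⟩
      v (suc k) +ₛ p *ₛ x k *ₛ v (suc k)
        ≈⟨ solve 2 (λ y v → v :+ y :* v := (con (+ 1) :+ y) :* v) ≈-refl (p *ₛ x k) (v (suc k)) ⟩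
      (oneₛ +ₛ p *ₛ x k) *ₛ v (suc k) ∎
      where
      u : Series
      u = oneColor w (suc (k ℕ.* 2))

    blue-step : ∀ k → (oneₛ +ₛ (-ₛ x k)) *ₛ blue w (k ℕ.* 2) ≈ x k *ₛ v (suc k)
    blue-step k = begin
      (oneₛ +ₛ (-ₛ x k)) *ₛ b
        ≈⟨ solve 2 (λ x b → (con (+ 1) :- x) :* b := b :- x :* b) ≈-refl (x k) b ⟩
      b +ₛ (-ₛ (x k *ₛ b))
        ≈⟨ +-congʳ (-ₛ (x k *ₛ b)) (≈⇒Agree (blue-odd w (k ℕ.* 2) (even⇒odd-suc (even-double k)))) ⟩
      x k *ₛ (v (suc k) +ₛ b) +ₛ (-ₛ (x k *ₛ b))
        ≈⟨ solve 3 (λ x v b → x :* (v :+ b) :- x :* b := x :* v) ≈-refl (x k) (v (suc k)) b ⟩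
      x k *ₛ v (suc k) ∎
      where
      b : Series
      b = blue w (k ℕ.* 2)

    c : Series
    c = (oneₛ +ₛ p) *ₛ (oneₛ +ₛ p)

    potential : ℕ → Series
    potential k = (x k +ₛ p) *ₛ (v k *ₛ v k)

    -- After multiplication by (1 - x)² everything is a multiple of v(s+2)². The claim is then (x +
    -- p)(1 + p x)² - (p² x + p)(1 - x)² = (1 + p)² x (1 + p x): since p² x + p = p (1 + p x), a
    -- factor 1 + p x splits off, and what is left, (x + p)(1 + p x) - p (1 - x)², collapses to x (1
    -- + p)². This is where the constant (1 + p)² comes from.
    telescope : ∀ k → c *ₛ blueGreen w k +ₛ potential (suc k) ≈ potential k
    telescope k = cancel (d *ₛ d) refl (begin
      d *ₛ d *ₛ ((oneₛ +ₛ p) *ₛ (oneₛ +ₛ p) *ₛ (b *ₛ v k) +ₛ (x (suc k) +ₛ p) *ₛ (v′ *ₛ v′))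
        ≈⟨ *-congˡ (d *ₛ d) (+-congˡ (c *ₛ (b *ₛ v k)) (*-congʳ (v′ *ₛ v′) (+-congʳ p (ppx k)))) ⟩
      d *ₛ d *ₛ ((oneₛ +ₛ p) *ₛ (oneₛ +ₛ p) *ₛ (b *ₛ v k) +ₛ (p *ₛ (p *ₛ x k) +ₛ p) *ₛ (v′ *ₛ v′))
        -- Here `d` stays a variable, so that the products d b and d v remain intact for `blue-step`
        -- and `v-step`; it is expanded as 1 - x only after these have been applied.
        ≈⟨ solve 6 (λ d p x b v v′ →
             d :* d :* ((con (+ 1) :+ p) :* (con (+ 1) :+ p) :* (b :* v) :+ (p :* (p :* x) :+ p) :* (v′ :* v′))
             := (con (+ 1) :+ p) :* (con (+ 1) :+ p) :* ((d :* b) :* (d :* v))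
                :+ d :* d :* ((p :* (p :* x) :+ p) :* (v′ :* v′)))
             ≈-refl d p (x k) b (v k) v′ ⟩
      (oneₛ +ₛ p) *ₛ (oneₛ +ₛ p) *ₛ ((d *ₛ b) *ₛ (d *ₛ v k))
        +ₛ d *ₛ d *ₛ ((p *ₛ (p *ₛ x k) +ₛ p) *ₛ (v′ *ₛ v′))
        ≈⟨ +-congʳ (d *ₛ d *ₛ ((p *ₛ (p *ₛ x k) +ₛ p) *ₛ (v′ *ₛ v′))) (*-congˡ c (*-cong (blue-step k) (v-step k))) ⟩
      (oneₛ +ₛ p) *ₛ (oneₛ +ₛ p) *ₛ ((x k *ₛ v′) *ₛ ((oneₛ +ₛ p *ₛ x k) *ₛ v′))
        +ₛ d *ₛ d *ₛ ((p *ₛ (p *ₛ x k) +ₛ p) *ₛ (v′ *ₛ v′))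
        ≈⟨ solve 3 (λ p x v′ →
             (con (+ 1) :+ p) :* (con (+ 1) :+ p) :* ((x :* v′) :* ((con (+ 1) :+ p :* x) :* v′))
             :+ (con (+ 1) :- x) :* (con (+ 1) :- x) :* ((p :* (p :* x) :+ p) :* (v′ :* v′))
             := (x :+ p) :* (((con (+ 1) :+ p :* x) :* v′) :* ((con (+ 1) :+ p :* x) :* v′)))
             ≈-refl p (x k) v′ ⟩
      (x k +ₛ p) *ₛ (((oneₛ +ₛ p *ₛ x k) *ₛ v′) *ₛ ((oneₛ +ₛ p *ₛ x k) *ₛ v′))
        ≈⟨ *-congˡ (x k +ₛ p) (*-cong (v-step k) (v-step k)) ⟨
      (x k +ₛ p) *ₛ ((d *ₛ v k) *ₛ (d *ₛ v k))
        ≈⟨ solve 3 (λ y d v → y :* ((d :* v) :* (d :* v)) := d :* d :* (y :* (v :* v))) ≈-refl (x k +ₛ p) d (v k) ⟩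
      d *ₛ d *ₛ ((x k +ₛ p) *ₛ (v k *ₛ v k)) ∎)
      where
      b v′ d : Series
      b  = blue w (k ℕ.* 2)
      v′ = v (suc k)
      d  = oneₛ +ₛ (-ₛ x k)

    telescoped : ∀ k → c *ₛ ∑blueGreen w k +ₛ potential k ≈ potential 0
    telescoped zero    = ≈-trans (+-congʳ (potential 0) (*-congˡ c zeroₛ≈)) (solve 2 (λ c u → c :* con (+ 0) :+ u := u) ≈-refl c (potential 0))
    telescoped (suc k) = begin
      c *ₛ (∑blueGreen w k +ₛ blueGreen w k) +ₛ potential (suc k)
        ≈⟨ solve 4 (λ c s t u → c :* (s :+ t) :+ u := c :* s :+ (c :* t :+ u)) ≈-refl
             c (∑blueGreen w k) (blueGreen w k) (potential (suc k)) ⟩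
      c *ₛ ∑blueGreen w k +ₛ (c *ₛ blueGreen w k +ₛ potential (suc k))
        ≈⟨ +-congˡ (c *ₛ ∑blueGreen w k) (telescope k) ⟩
      c *ₛ ∑blueGreen w k +ₛ potential k
        ≈⟨ telescoped k ⟩
      potential 0 ∎

    -- For n ≤ k the last potential is exactly p in the truncated ring: the exponent 2k + 1 of `x k`
    -- exceeds n, and `v k` is 1.
    ∑blueGreen-closed : ∀ {k} → n ≤ k →
      c *ₛ ∑blueGreen w k +ₛ p ≈ (q +ₛ p) *ₛ (v 0 *ₛ v 0)
    ∑blueGreen-closed {k} n≤k = ≈-trans (+-congˡ (c *ₛ ∑blueGreen w k) (≈-sym limit)) (telescoped k)
      where
      n≤2k : n ≤ k ℕ.* 2
      n≤2k = ℕ.≤-trans n≤k (ℕ.m≤m*n k 2)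
      limit : potential k ≈ p
      limit = begin
        (x k +ₛ p) *ₛ (v k *ₛ v k)
          ≈⟨ *-cong (+-congʳ p (mono-> (+ 1) (s≤s n≤2k))) (*-cong (oneColor-≈1 w n≤2k) (oneColor-≈1 w n≤2k)) ⟩
        (mono (+ 0) 0 +ₛ p) *ₛ (oneₛ *ₛ oneₛ)
          ≈⟨ solve 1 (λ p → (con (+ 0) :+ p) :* (con (+ 1) :* con (+ 1)) := p) ≈-refl p ⟩
        p ∎

  -- Finite products and Euler's identity.

  finNegPoch-stable : ∀ a d {k} i → n ≤ k → finNegPoch (suc a) (suc d) (i ℕ.+ k) ≈ finNegPoch (suc a) (suc d) k
  finNegPoch-stable a d     zero    n≤k = ≈-refl
  finNegPoch-stable a d {k} (suc i) n≤k = begin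
    f *ₛ (oneₛ +ₛ mono (+ 1) (suc a ℕ.+ suc d ℕ.* (i ℕ.+ k)))
      ≈⟨ *-congˡ f (+-congˡ oneₛ (mono-> (+ 1) (s≤s n≤exponent))) ⟩
    f *ₛ (oneₛ +ₛ mono (+ 0) 0)
      ≈⟨ solve 1 (λ f → f :* (con (+ 1) :+ con (+ 0)) := f) ≈-refl f ⟩
    f
      ≈⟨ finNegPoch-stable a d i n≤k ⟩
    finNegPoch (suc a) (suc d) k ∎
    where
    f : Series
    f = finNegPoch (suc a) (suc d) (i ℕ.+ k)
    n≤exponent : n ≤ a ℕ.+ suc d ℕ.* (i ℕ.+ k)
    n≤exponent = ℕ.≤-trans n≤k (ℕ.≤-trans (ℕ.m≤n+m k i) (ℕ.≤-trans (ℕ.m≤n*m (i ℕ.+ k) (suc d)) (ℕ.m≤n+m _ a)))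

  evenPoch-stable : ∀ {k} i → n ≤ k → evenPoch (i ℕ.+ k) ≈ evenPoch k
  evenPoch-stable     zero    n≤k = ≈-refl
  evenPoch-stable {k} (suc i) n≤k = begin
    f *ₛ (oneₛ +ₛ (-ₛ mono (+ 1) (suc (i ℕ.+ k) ℕ.* 2)))
      ≈⟨ *-congˡ f (+-congˡ oneₛ (-‿cong (mono-> (+ 1) (s≤s (ℕ.m≤n⇒m≤1+n n≤exponent))))) ⟩
    f *ₛ (oneₛ +ₛ (-ₛ mono (+ 0) 0))
      ≈⟨ solve 1 (λ f → f :* (con (+ 1) :- con (+ 0)) := f) ≈-refl f ⟩
    f
      ≈⟨ evenPoch-stable i n≤k ⟩
    evenPoch k ∎
    where
    f : Series
    f = evenPoch (i ℕ.+ k)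
    n≤exponent : n ≤ (i ℕ.+ k) ℕ.* 2
    n≤exponent = ℕ.≤-trans n≤k (ℕ.≤-trans (ℕ.m≤n+m k i) (ℕ.m≤m*n (i ℕ.+ k) 2))

  mono-double : ∀ j → mono (+ 1) (j ℕ.* 2) ≈ mono (+ 1) j *ₛ mono (+ 1) j
  mono-double j = ≈-trans
    (mono-≈ (+ 1) (trans (ℕ.*-comm j 2) (cong (j ℕ.+_) (ℕ.+-identityʳ j))))
    (≈-sym (≈⇒Agree (mono-*-mono (+ 1) j (+ 1) j)))

  -- The odd and even factors combine to (q;q)_2k, and pairing 1 + q^j with 1 - q^j then turns
  -- (-q;q)_2k (q;q)_2k into (q²;q²)_2k.
  euler-finite : ∀ k → finNegPoch 1 1 (k ℕ.* 2) *ₛ oddPoch k *ₛ evenPoch k ≈ evenPoch (k ℕ.* 2)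
  euler-finite zero    = solve 0 (con (+ 1) :* con (+ 1) :* con (+ 1) := con (+ 1)) ≈-refl
  euler-finite (suc k) = begin
    a *ₛ (oneₛ +ₛ mono (+ 1) (1 ℕ.+ 1 ℕ.* (k ℕ.* 2))) *ₛ (oneₛ +ₛ mono (+ 1) (1 ℕ.+ 1 ℕ.* suc (k ℕ.* 2)))
      *ₛ (o *ₛ (oneₛ +ₛ (-ₛ x k))) *ₛ (m *ₛ (oneₛ +ₛ (-ₛ y)))
      ≈⟨ *-congʳ (m *ₛ (oneₛ +ₛ (-ₛ y))) (*-congʳ (o *ₛ (oneₛ +ₛ (-ₛ x k)))
           (*-cong (*-congˡ a (+-congˡ oneₛ (mono-≈ (+ 1) (cong suc (ℕ.*-identityˡ (k ℕ.* 2))))))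
                   (+-congˡ oneₛ (mono-≈ (+ 1) (cong suc (ℕ.*-identityˡ (suc (k ℕ.* 2)))))))) ⟩
    a *ₛ (oneₛ +ₛ x k) *ₛ (oneₛ +ₛ y) *ₛ (o *ₛ (oneₛ +ₛ (-ₛ x k))) *ₛ (m *ₛ (oneₛ +ₛ (-ₛ y)))
      ≈⟨ solve 5 (λ a o m x y →
           a :* (con (+ 1) :+ x) :* (con (+ 1) :+ y) :* (o :* (con (+ 1) :- x)) :* (m :* (con (+ 1) :- y))
           := a :* o :* m :* (con (+ 1) :- x :* x) :* (con (+ 1) :- y :* y)) ≈-refl a o m (x k) y ⟩
    a *ₛ o *ₛ m *ₛ (oneₛ +ₛ (-ₛ (x k *ₛ x k))) *ₛ (oneₛ +ₛ (-ₛ (y *ₛ y)))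
      ≈⟨ *-cong (*-cong (euler-finite k) (+-congˡ oneₛ (-‿cong (≈-sym (mono-double (suc (k ℕ.* 2)))))))
                (+-congˡ oneₛ (-‿cong (≈-sym (mono-double (suc k ℕ.* 2))))) ⟩
    evenPoch (suc k ℕ.* 2) ∎
    where
    a o m y : Series
    a = finNegPoch 1 1 (k ℕ.* 2)
    o = oddPoch k
    m = evenPoch k
    y = mono (+ 1) (suc k ℕ.* 2)

  -- For k ≥ n the products (q²;q²)_2k and (q²;q²)_k agree modulo qⁿ⁺¹, so the cofactor of
  -- `euler-finite` cancels.
  euler : ∀ {k} → n ≤ k → finNegPoch 1 1 (k ℕ.* 2) *ₛ oddPoch k ≈ oneₛ
  euler {k} n≤k = cancel m (evenPoch-0 k) (begin
    m *ₛ (a *ₛ oddPoch k)        ≈⟨ solve 3 (λ m a o → m :* (a :* o) := a :* o :* m) ≈-refl m a (oddPoch k) ⟩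
    a *ₛ oddPoch k *ₛ m          ≈⟨ euler-finite k ⟩
    evenPoch (k ℕ.* 2)           ≈⟨ ≈-reflexive (cong evenPoch (trans (ℕ.*-comm k 2) (cong (k ℕ.+_) (ℕ.+-identityʳ k)))) ⟩
    evenPoch (k ℕ.+ k)           ≈⟨ evenPoch-stable k n≤k ⟩
    m                            ≈⟨ solve 1 (λ m → m := m :* con (+ 1)) ≈-refl m ⟩
    m *ₛ oneₛ                    ∎)
    where
    a m : Series
    a = finNegPoch 1 1 (k ℕ.* 2)
    m = evenPoch k

  -- Euler's product begins with 1 + q, the product of the theorem with 1 + q². The factor split off
  -- here is the one whose square later cancels (1 + p)².
  finNegPoch-1-suc : ∀ m → finNegPoch 1 1 (suc m) ≈ (oneₛ +ₛ q) *ₛ finNegPoch 2 1 m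
  finNegPoch-1-suc zero    = solve 1 (λ q → con (+ 1) :* (con (+ 1) :+ q) := (con (+ 1) :+ q) :* con (+ 1)) ≈-refl q
  finNegPoch-1-suc (suc m) = begin
    finNegPoch 1 1 (suc m) *ₛ f                ≈⟨ *-congʳ f (finNegPoch-1-suc m) ⟩
    (oneₛ +ₛ q) *ₛ finNegPoch 2 1 m *ₛ f       ≈⟨ solve 3 (λ a b c → a :* b :* c := a :* (b :* c)) ≈-refl
                                                    (oneₛ +ₛ q) (finNegPoch 2 1 m) f ⟩
    (oneₛ +ₛ q) *ₛ (finNegPoch 2 1 m *ₛ f)     ∎
    where
    f : Series
    f = oneₛ +ₛ mono (+ 1) (2 ℕ.+ 1 ℕ.* m)

  open Weighted (+ 1) refl using (p; v; px; v-step)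


  -- This is `v-step` iterated k times for w = 1, with the denominators cleared.
  v₀-oddPoch : ∀ k → v 0 *ₛ oddPoch k ≈ finNegPoch 2 2 k *ₛ v k
  v₀-oddPoch zero    = solve 1 (λ v → v :* con (+ 1) := con (+ 1) :* v) ≈-refl (v 0)
  v₀-oddPoch (suc k) = begin
    v 0 *ₛ (oddPoch k *ₛ d)
      ≈⟨ solve 3 (λ a b c → a :* (b :* c) := c :* (a :* b)) ≈-refl (v 0) (oddPoch k) d ⟩
    d *ₛ (v 0 *ₛ oddPoch k)
      ≈⟨ *-congˡ d (v₀-oddPoch k) ⟩
    d *ₛ (e *ₛ v k)
      ≈⟨ solve 3 (λ a b c → a :* (b :* c) := b :* (a :* c)) ≈-refl d e (v k) ⟩
    e *ₛ (d *ₛ v k)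
      ≈⟨ *-congˡ e (v-step k) ⟩
    e *ₛ ((oneₛ +ₛ p *ₛ x k) *ₛ v (suc k))
      ≈⟨ *-congˡ e (*-congʳ (v (suc k)) (+-congˡ oneₛ (≈-trans (≈-sym (px k))
           (mono-≈ (+ 1) (cong (suc ∘ suc) (ℕ.*-comm k 2)))))) ⟩
    e *ₛ (f *ₛ v (suc k))
      ≈⟨ solve 3 (λ a b c → a :* (b :* c) := a :* b :* c) ≈-refl e f (v (suc k)) ⟩
    e *ₛ f *ₛ v (suc k) ∎
    where
    d e f : Series
    d = oneₛ +ₛ (-ₛ x k)
    e = finNegPoch 2 2 k
    f = oneₛ +ₛ mono (+ 1) (2 ℕ.+ 2 ℕ.* k)

-- Each coefficient of `negPoch` is taken from a finite product of its own length. In degree m all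
-- products with at least m factors agree, so the comparison is made in the ring truncated at m
-- rather than at n.
negPoch-agree : ∀ {n j} a d → n ≤ j → Agree n (negPoch (suc a) (suc d)) (finNegPoch (suc a) (suc d) j)
negPoch-agree {n} {j} a d n≤j = mk λ {m} m≤n →
  let open Identities m using (finNegPoch-stable) in trans
    (at (finNegPoch-stable a d {m} 1 ℕ.≤-refl) ℕ.≤-refl)
    (sym (trans (cong (λ i → finNegPoch (suc a) (suc d) i m) (sym (ℕ.m∸n+n≡m (ℕ.≤-trans m≤n n≤j))))
                (at (finNegPoch-stable a d {m} (j ∸ m) ℕ.≤-refl) ℕ.≤-refl)))

-- The series q/(1 - q)² and -q/(1 + q)².

linear-*-0 : ∀ c f → ((oneₛ +ₛ mono c 1) *ₛ f) 0 ≡ f 0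
linear-*-0 c f = ℤ.*-identityˡ (f 0)

linear-*-suc : ∀ c f m → ((oneₛ +ₛ mono c 1) *ₛ f) (suc m) ≡ f (suc m) + c * f m
linear-*-suc c f m = trans (*ₛ-distribʳ oneₛ (mono c 1) f (suc m))
  (cong₂ _+_ (*ₛ-identityˡ f (suc m)) (mono-*-+ c f 1 m))

-- s is the geometric series 1/(1 + c q), and m s(m) are the coefficients of q times its derivative.
linear²-* : ∀ c (s : ℕ → ℤ) → s 0 ≡ + 1 → (∀ m → s (suc m) ≡ - (c * s m)) →
            ((oneₛ +ₛ mono c 1) *ₛ (oneₛ +ₛ mono c 1) *ₛ (λ m → s m * + m)) ≈ₛ mono (- c) 1
linear²-* c s s₀ s-suc m = trans (*ₛ-assoc l l f m) (coefficient m)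
  where
  open ≡-Reasoning
  l f y : Series
  l = oneₛ +ₛ mono c 1
  f m = s m * + m
  y = l *ₛ f
  y-0 : y 0 ≡ + 0
  y-0 = trans (linear-*-0 c f) (ℤ.*-zeroʳ (s 0))
  y-suc : ∀ m → y (suc m) ≡ s (suc m)
  y-suc m = begin
    y (suc m)                                   ≡⟨ linear-*-suc c f m ⟩
    s (suc m) * + suc m + c * (s m * + m)       ≡⟨ cong (λ z → z * + suc m + c * (s m * + m)) (s-suc m) ⟩
    - (c * s m) * (+ 1 + + m) + c * (s m * + m) ≡⟨ collapse c (s m) (+ m) ⟩
    - (c * s m)                                 ≡⟨ s-suc m ⟨
    s (suc m)                                   ∎
    where
    collapse : ∀ c s m → - (c * s) * (+ 1 + m) + c * (s * m) ≡ - (c * s)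
    collapse = solve-∀
  coefficient : ∀ m → (l *ₛ y) m ≡ mono (- c) 1 m
  coefficient zero          = trans (linear-*-0 c y) y-0
  coefficient (suc zero)    = begin
    (l *ₛ y) 1             ≡⟨ linear-*-suc c y 0 ⟩
    y 1 + c * y 0          ≡⟨ cong₂ (λ a b → a + c * b) (trans (y-suc 0) (s-suc 0)) y-0 ⟩
    - (c * s 0) + c * + 0  ≡⟨ cong (λ z → - (c * z) + c * + 0) s₀ ⟩
    - (c * + 1) + c * + 0  ≡⟨ collapse c ⟩
    - c                    ∎
    where
    collapse : ∀ c → - (c * + 1) + c * + 0 ≡ - c
    collapse = solve-∀
  coefficient (suc (suc m)) = begin
    (l *ₛ y) (suc (suc m))            ≡⟨ linear-*-suc c y (suc m) ⟩
    y (suc (suc m)) + c * y (suc m)   ≡⟨ cong₂ (λ a b → a + c * b) (trans (y-suc (suc m)) (s-suc (suc m))) (y-suc m) ⟩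
    - (c * s (suc m)) + c * s (suc m) ≡⟨ ℤ.+-inverseˡ (c * s (suc m)) ⟩
    + 0                               ∎

altN-identity : ((oneₛ +ₛ mono (+ 1) 1) *ₛ (oneₛ +ₛ mono (+ 1) 1) *ₛ altNₛ) ≈ₛ mono (- (+ 1)) 1
altN-identity = linear²-* (+ 1) sgn refl (λ m → cong -_ (sym (ℤ.*-identityˡ (sgn m))))

nat-identity : ((oneₛ +ₛ mono (- (+ 1)) 1) *ₛ (oneₛ +ₛ mono (- (+ 1)) 1) *ₛ natₛ) ≈ₛ mono (+ 1) 1
nat-identity m = trans
  (*ₛ-congˡ-≈ ((oneₛ +ₛ mono (- (+ 1)) 1) *ₛ (oneₛ +ₛ mono (- (+ 1)) 1)) (λ i → sym (ℤ.*-identityˡ (+ i))) m)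
  (linear²-* (- (+ 1)) (λ _ → + 1) refl (λ _ → refl) m)

-- The two sums in closed form.

module ClosedForms (n : ℕ) where
  open Truncated n
  open Solver using (solve; _:=_; _:+_; _:*_; _:-_; con)
  open Relation.Binary.Reasoning.Setoid setoid
  open Identities n


  -- With v(2k+1) = 1 in the truncated ring, `v₀-oddPoch` reads v(1) (q;q²)_k = (-q²;q²)_k. Euler's
  -- identity supplies the inverse of (q;q²)_k, entering as a product equal to 1.
  v₀-product : oneColor (+ 1) 0 ≈ (oneₛ +ₛ q) *ₛ negPoch 2 1 *ₛ negPoch 2 2
  v₀-product = cancel o (oddPoch-0 k) (begin
    o *ₛ v 0
      ≈⟨ solve 2 (λ a b → a :* b := b :* a) ≈-refl o (v 0) ⟩
    v 0 *ₛ o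
      ≈⟨ v₀-oddPoch k ⟩
    finNegPoch 2 2 k *ₛ v k
      ≈⟨ *-cong (≈-sym (negPoch-agree 1 1 (ℕ.n≤1+n n))) (oneColor-≈1 (+ 1) (ℕ.≤-trans (ℕ.n≤1+n n) (ℕ.m≤m*n k 2))) ⟩
    e *ₛ oneₛ
      ≈⟨ *-congˡ e (euler (ℕ.n≤1+n n)) ⟨
    e *ₛ (finNegPoch 1 1 (k ℕ.* 2) *ₛ o)
      ≈⟨ *-congˡ e (*-congʳ o (≈-trans (finNegPoch-1-suc (suc (n ℕ.* 2)))
           (*-congˡ (oneₛ +ₛ q) (≈-sym (negPoch-agree 1 0 (ℕ.m≤n⇒m≤1+n (ℕ.m≤m*n n 2))))))) ⟩
    e *ₛ ((oneₛ +ₛ q) *ₛ negPoch 2 1 *ₛ o)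
      ≈⟨ solve 4 (λ e c d o → e :* (c :* d :* o) := o :* (c :* d :* e)) ≈-refl e (oneₛ +ₛ q) (negPoch 2 1) o ⟩
    o *ₛ ((oneₛ +ₛ q) *ₛ negPoch 2 1 *ₛ e) ∎)
    where
    open Weighted (+ 1) refl using (v)
    -- One more than n, so that `k * 2` is visibly a successor and `finNegPoch-1-suc` can split off
    -- 1 + q.
    k : ℕ
    k = suc n
    o e : Series
    o = oddPoch k
    e = negPoch 2 2

  mono-1 : ∀ c → mono c 1 ≈ mono c 0 *ₛ q
  mono-1 c = ≈-sym (≈-trans (≈⇒Agree (mono-*-mono c 0 (+ 1) 1)) (≈-reflexive (cong (λ d → mono d 1) (ℤ.*-identityʳ c))))

  ∑blueGreen-product : ∑blueGreen (+ 1) n ≈ twoQP +ₛ altNₛ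
  ∑blueGreen-product = cancel c refl (begin
    c *ₛ ∑blueGreen (+ 1) n
      ≈⟨ solve 2 (λ s q → s := (s :+ q) :- q) ≈-refl (c *ₛ ∑blueGreen (+ 1) n) q ⟩
    (c *ₛ ∑blueGreen (+ 1) n +ₛ q) +ₛ (-ₛ q)
      ≈⟨ +-congʳ (-ₛ q) (≈-trans (∑blueGreen-closed {n} ℕ.≤-refl) (*-congˡ (q +ₛ q) (*-cong v₀-product v₀-product))) ⟩
    (q +ₛ q) *ₛ (((oneₛ +ₛ q) *ₛ d *ₛ e) *ₛ ((oneₛ +ₛ q) *ₛ d *ₛ e)) +ₛ (-ₛ q)
      -- The two factors 1 + q coming from v(1)² form exactly `c`. The remaining -q becomes a
      -- multiple of `c` through `altN-identity`.
      ≈⟨ solve 3 (λ q d e →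
           (q :+ q) :* (((con (+ 1) :+ q) :* d :* e) :* ((con (+ 1) :+ q) :* d :* e)) :- q
           := (con (+ 1) :+ q) :* (con (+ 1) :+ q) :* (con (+ 2) :* q :* (d :* d :* e :* e)) :+ con (- (+ 1)) :* q)
           ≈-refl q d e ⟩
    c *ₛ (mono (+ 2) 0 *ₛ q *ₛ Pₛ) +ₛ mono (- (+ 1)) 0 *ₛ q
      ≈⟨ +-cong (*-congˡ c (*-congʳ Pₛ (≈-sym (mono-1 (+ 2))))) (≈-sym (mono-1 (- (+ 1)))) ⟩
    c *ₛ twoQP +ₛ mono (- (+ 1)) 1
      ≈⟨ +-congˡ (c *ₛ twoQP) (≈-sym (≈⇒Agree altN-identity)) ⟩
    c *ₛ twoQP +ₛ c *ₛ altNₛ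
      ≈⟨ solve 3 (λ c a b → c :* a :+ c :* b := c :* (a :+ b)) ≈-refl c twoQP altNₛ ⟩
    c *ₛ (twoQP +ₛ altNₛ) ∎)
    where
    open Weighted (+ 1) refl using (∑blueGreen-closed)
    c d e : Series
    c = (oneₛ +ₛ q) *ₛ (oneₛ +ₛ q)
    d = negPoch 2 1
    e = negPoch 2 2

  ∑blueGreen-nat : ∑blueGreen (- (+ 1)) n ≈ natₛ
  ∑blueGreen-nat = cancel c refl (begin
    c *ₛ ∑blueGreen (- (+ 1)) n
      ≈⟨ solve 2 (λ s p → s := (s :+ p) :- p) ≈-refl (c *ₛ ∑blueGreen (- (+ 1)) n) p ⟩
    (c *ₛ ∑blueGreen (- (+ 1)) n +ₛ p) +ₛ (-ₛ p)
      ≈⟨ +-congʳ (-ₛ p) (∑blueGreen-closed {n} ℕ.≤-refl) ⟩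
    (q +ₛ p) *ₛ (v 0 *ₛ v 0) +ₛ (-ₛ p)
      ≈⟨ +-cong (*-congʳ (v 0 *ₛ v 0) (+-congˡ q (mono-1 (- (+ 1))))) (-‿cong (mono-1 (- (+ 1)))) ⟩
    (q +ₛ mono (- (+ 1)) 0 *ₛ q) *ₛ (v 0 *ₛ v 0) +ₛ (-ₛ (mono (- (+ 1)) 0 *ₛ q))
      ≈⟨ solve 2 (λ q v → (q :+ con (- (+ 1)) :* q) :* (v :* v) :- con (- (+ 1)) :* q := q) ≈-refl q (v 0) ⟩
    q
      ≈⟨ ≈⇒Agree nat-identity ⟨
    c *ₛ natₛ ∎)
    where
    open Weighted (- (+ 1)) refl using (p; v; ∑blueGreen-closed)
    c : Series
    c = (oneₛ +ₛ p) *ₛ (oneₛ +ₛ p)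

-- Two-colour partitions

pairSize : TwoColor → ℕ
pairSize (b , g) = sum b ℕ.+ sum g

BlueGreen : ℕ → TwoColor → Set
BlueGreen s (b , g) = Blue s b × OneColor s g

blueGreen-GF : ∀ w k → HasGF pairSize (pairWeight (weight w) (weight w)) (BlueGreen (suc (k ℕ.* 2))) (blueGreen w k)
blueGreen-GF w k = HasGF-× (blue-GF w (k ℕ.* 2)) (oneColor-GF w (k ℕ.* 2))

-- One index bounds all parts from below while the other is itself a part. Used to show that the
-- classes for different smallest parts are disjoint, so that their series add.
BlueGreen-smallest : ∀ {s t p} → BlueGreen s p → BlueGreen t p → s ≤ t
BlueGreen-smallest (((_ , ≥s , _) , _ , _) , _) ((_ , t∈b , _) , _) = All.lookup ≥s t∈b

BlueGreen< : ℕ → TwoColor → Set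
BlueGreen< K p = ∃ λ k → k < K × BlueGreen (suc (k ℕ.* 2)) p

∑blueGreen-GF : ∀ w K → HasGF pairSize (pairWeight (weight w) (weight w)) (BlueGreen< K) (∑blueGreen w K)
∑blueGreen-GF w zero    n = Total-∅ λ { _ ((_ , () , _) , _) }
∑blueGreen-GF w (suc K) = HasGF-⇔
  (λ p → mk⇔
    (λ { (inj₁ (k , k<K , bg)) → k , ℕ.m≤n⇒m≤1+n k<K , bg ; (inj₂ bg) → K , ℕ.≤-refl , bg })
    (λ { (k , k<1+K , bg) → split k<1+K bg }))
  (HasGF-⊎ (λ { p (k , k<K , bg) bg′ →
      ℕ.<⇒≱ k<K (ℕ.*-cancelʳ-≤ K k 2 (ℕ.s≤s⁻¹ (BlueGreen-smallest {p = p} bg′ bg))) })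
    (∑blueGreen-GF w K) (blueGreen-GF w K))
  where
  split : ∀ {k p} → k < suc K → BlueGreen (suc (k ℕ.* 2)) p → BlueGreen< K p ⊎ BlueGreen (suc (K ℕ.* 2)) p
  split {k} k<1+K bg with ℕ.m≤n⇒m<n∨m≡n (ℕ.s≤s⁻¹ k<1+K)
  ... | inj₁ k<K  = inj₁ (k , k<K , bg)
  ... | inj₂ refl = inj₂ bg

∈⇒≤sum : ∀ {x xs} → x ∈ xs → x ≤ sum xs
∈⇒≤sum {xs = x ∷ xs} (here refl) = ℕ.m≤m+n x (sum xs)
∈⇒≤sum {xs = y ∷ xs} (there x∈)  = ℕ.≤-trans (∈⇒≤sum x∈) (ℕ.m≤n+m (sum xs) y)

-- The smallest part 2k + 1 is at most the total n, which forces k < n: the first n classes already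
-- contain every partition of n.
BlueGreen<⇔IsA : ∀ n p → (BlueGreen< n p × pairSize p ≡ n) ⇔ IsA n p
BlueGreen<⇔IsA n (b , g) = mk⇔ forget build
  where
  forget : BlueGreen< n (b , g) × pairSize (b , g) ≡ n → IsA n (b , g)
  forget ((k , _ , ((b≥ , ≥s , b-distinct) , s∈b , s+1∉b) , (g≥ , g≥s , g-distinct)) , e) =
    (b≥ , All.map positive ≥s) , (g≥ , All.map positive g≥s) , e ,
    (suc (k ℕ.* 2) , s∈b , odd , All.++⁺ ≥s g≥s , All.tabulate far) , b-distinct , g-distinct
    where
    odd : Odd (suc (k ℕ.* 2))
    odd = even⇒odd-suc (even-double k)
    positive : ∀ {x} → suc (k ℕ.* 2) ≤ x → 1 ≤ x
    positive = ℕ.≤-trans (s≤s z≤n)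
    far : ∀ {x} → x ∈ b → Even x → suc (k ℕ.* 2) ℕ.+ 3 ≤ x
    -- Starting from s ≤ x, the three inequalities exclude s because it is odd, s + 1 because it is
    -- forbidden, and s + 2 because it is odd.
    far {x} x∈b even = subst (_≤ x) (ℕ.+-comm 3 (suc (k ℕ.* 2)))
      (ℕ.≤∧≢⇒< (ℕ.≤∧≢⇒< (ℕ.≤∧≢⇒< (All.lookup ≥s x∈b) (λ { refl → odd even })) (λ { refl → s+1∉b x∈b }))
        (λ { refl → even⇒odd-suc (even-double (suc k)) even }))
  build : IsA n (b , g) → BlueGreen< n (b , g) × pairSize (b , g) ≡ n
  build ((b≥ , _) , (g≥ , _) , e , (s , s∈b , odd , ≥s , far) , b-distinct , g-distinct) with odd⇒double s odd
  ... | k , refl =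
    (k , k<n , ((b≥ , All.++⁻ˡ b ≥s , b-distinct) , s∈b , s+1∉b) , (g≥ , All.++⁻ʳ b ≥s , g-distinct)) , e
    where
    k<n : k < n
    k<n = ℕ.≤-trans (s≤s (ℕ.m≤m*n k 2)) (ℕ.≤-trans (∈⇒≤sum s∈b) (ℕ.≤-trans (ℕ.m≤m+n (sum b) (sum g)) (ℕ.≤-reflexive e)))
    s+1∉b : suc (suc (k ℕ.* 2)) ∉ b
    s+1∉b s+1∈b with ℕ.+-cancelʳ-≤ (suc (k ℕ.* 2)) 3 1
      (subst (_≤ suc (suc (k ℕ.* 2))) (ℕ.+-comm (suc (k ℕ.* 2)) 3) (All.lookup far s+1∈b (even-double (suc k))))
    ... | s≤s ()

IsA-total : ∀ w n → Total (λ p → w ^ numEven p) (IsA n) (∑blueGreen w n n)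
IsA-total w n = reweigh (Total-⇔ (BlueGreen<⇔IsA n) (∑blueGreen-GF w n n))
  where
  reweigh : ∀ {P c} → Total (pairWeight (weight w) (weight w)) P c → Total (λ p → w ^ numEven p) P c
  reweigh (total xs xs! xs∋ e) = total xs xs! xs∋ (trans (sym (go xs)) e)
    where
    go : ∀ ps → wsum (pairWeight (weight w) (weight w)) ps ≡ wsum (λ p → w ^ numEven p) ps
    go []             = refl
    go ((b , g) ∷ ps) = cong₂ _+_ (sym (weight-++ w b g)) (go ps)

-- Plain and signed counts.

[-1]^even : ∀ {m} → Even m → (- (+ 1)) ^ m ≡ + 1
[-1]^even (divides k refl) = trans (cong ((- (+ 1)) ^_) (ℕ.*-comm k 2))
  (trans (sym (ℤ.^-*-assoc (- (+ 1)) 2 k)) (ℤ.^-zeroˡ k))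

[-1]^odd : ∀ {m} → Odd m → (- (+ 1)) ^ m ≡ - (+ 1)
[-1]^odd {m} odd with odd⇒double m odd
... | k , refl = cong (- (+ 1) *_) ([-1]^even (even-double k))

module _ {X : Set} (f : X → ℕ) where

  wsum-length : ∀ xs → wsum (λ x → (+ 1) ^ f x) xs ≡ + length xs
  wsum-length []       = refl
  wsum-length (x ∷ xs) = cong₂ _+_ (ℤ.^-zeroˡ (f x)) (wsum-length xs)

  even? : Decidable (λ x → Even (f x))
  even? x = 2 ∣? f x

  odd? : Decidable (λ x → Odd (f x))
  odd? x = ¬? (even? x)

  wsum-sign : ∀ xs → wsum (λ x → (- (+ 1)) ^ f x) xs ≡ + length (filter even? xs) - + length (filter odd? xs)
  wsum-sign []       = refl
  wsum-sign (x ∷ xs) = byParity (even? x)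
    where
    open ≡-Reasoning
    rearrange : ∀ a b → - (+ 1) + (a - b) ≡ a - (+ 1 + b)
    rearrange = solve-∀
    byParity : Dec (Even (f x)) →
               wsum (λ x → (- (+ 1)) ^ f x) (x ∷ xs) ≡ + length (filter even? (x ∷ xs)) - + length (filter odd? (x ∷ xs))
    byParity (yes even) = begin
      (- (+ 1)) ^ f x + wsum (λ x → (- (+ 1)) ^ f x) xs
        ≡⟨ cong₂ _+_ ([-1]^even even) (wsum-sign xs) ⟩
      + 1 + (+ length (filter even? xs) - + length (filter odd? xs))
        ≡⟨ ℤ.+-assoc (+ 1) (+ length (filter even? xs)) (- + length (filter odd? xs)) ⟨
      + suc (length (filter even? xs)) - + length (filter odd? xs)
        ≡⟨ cong₂ (λ a b → + length a - + length b)
             (filter-accept even? {x} {xs} even) (filter-reject odd? {x} {xs} (λ odd → odd even)) ⟨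
      + length (filter even? (x ∷ xs)) - + length (filter odd? (x ∷ xs)) ∎
    byParity (no odd) = begin
      (- (+ 1)) ^ f x + wsum (λ x → (- (+ 1)) ^ f x) xs
        ≡⟨ cong₂ _+_ ([-1]^odd odd) (wsum-sign xs) ⟩
      - (+ 1) + (+ length (filter even? xs) - + length (filter odd? xs))
        ≡⟨ rearrange (+ length (filter even? xs)) (+ length (filter odd? xs)) ⟩
      + length (filter even? xs) - + suc (length (filter odd? xs))
        ≡⟨ cong₂ (λ a b → + length a - + length b)
             (filter-reject even? {x} {xs} odd) (filter-accept odd? {x} {xs} odd) ⟨
      + length (filter even? (x ∷ xs)) - + length (filter odd? (x ∷ xs)) ∎

theorem5 : ((n : ℕ) → 1 ≤ n → Σ ℕ λ c → HasCount (IsA n) c × (+ c ≡ twoQP n + altNₛ n))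
    × (((oneₛ +ₛ mono (+ 1) 1) *ₛ (oneₛ +ₛ mono (+ 1) 1) *ₛ altNₛ) ≈ₛ mono (- (+ 1)) 1)
    × ((n : ℕ) → 1 ≤ n → Σ ℕ λ c₀ → Σ ℕ λ c₁ →
    HasCount (IsA₀ n) c₀ × HasCount (IsA₁ n) c₁ × (+ c₀ - + c₁ ≡ natₛ n))
    × (((oneₛ +ₛ mono (- (+ 1)) 1) *ₛ (oneₛ +ₛ mono (- (+ 1)) 1) *ₛ natₛ) ≈ₛ mono (+ 1) 1)
theorem5 = partA , altN-identity , partB , nat-identity
  where
  partA : (n : ℕ) → 1 ≤ n → Σ ℕ λ c → HasCount (IsA n) c × (+ c ≡ twoQP n + altNₛ n)
  partA n _ with IsA-total (+ 1) n
  ... | total ps ps! ps∋ e = length ps , (ps , ps! , ps∋ , refl) ,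
    trans (sym (wsum-length numEven ps)) (trans e (at (ClosedForms.∑blueGreen-product n) ℕ.≤-refl))
  partB : (n : ℕ) → 1 ≤ n → Σ ℕ λ c₀ → Σ ℕ λ c₁ →
          HasCount (IsA₀ n) c₀ × HasCount (IsA₁ n) c₁ × (+ c₀ - + c₁ ≡ natₛ n)
  partB n _ with IsA-total (- (+ 1)) n
  -- A single enumeration of all partitions serves both counts: splitting it by the parity of
  -- `numEven` turns its signed sum into their difference.
  ... | total ps ps! ps∋ e = length (filter (even? numEven) ps) , length (filter (odd? numEven) ps) ,
    (_ , Unique.filter⁺ (even? numEven) ps! , filter-member (even? numEven) ps∋ , refl) ,
    (_ , Unique.filter⁺ (odd? numEven) ps! , filter-member (odd? numEven) ps∋ , refl) ,
    trans (sym (wsum-sign numEven ps)) (trans e (at (ClosedForms.∑blueGreen-nat n) ℕ.≤-refl))
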